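{- Let $p$ be an odd prime such that $2$ is a primitive root modulo $p^2$, let $r\ge2$, and let $\mathcal{I}\subseteq\{0,1,\dots,p-1\}$ with $1\le|\mathcal{I}|\le(p-1)/2$. Let $(f(u))_{u\ge0}$ be the binary sequence of period $p^{r+1}$ with $f(u)=1$ if $u\bmod p^{r+1}\in\bigcup_{l\in\mathcal{I}}D_l$ and $f(u)=0$ otherwise. Then the $k$-error linear complexity over $\mathbb{F}_2$ of $(f(u))_{u\ge0}$ is as follows. If $|\mathcal{I}|$ is odd: $$LC_k^{\mathbb{F}_2}((f(u))_{u\ge0})=\begin{cases} p^{r+1}-p^r+p-1, & 0\le k<p^{r-1},\\ p^{r+1}-p^r+1, & p^{r-1}\le k<p^{r-1}(p-1),\\ p^{r+1}-p^r, & p^{r-1}(p-1)\le k<p^{r-1}(p-1)|\mathcal{I}| \text{ (when } |\mathcal{I}|>1),\\ 0, & k\ge p^{r-1}(p-1)|\mathcal{I}|.\end{cases}$$ If $|\mathcal{I}|$ is even: $$LC_k^{\mathbb{F}_2}((f(u))_{u\ge0})=\begin{cases} p^{r+1}-p^r, & 0\le k<p^{r-1}(p-1)|\mathcal{I}|,\\ 0, & k\ge p^{r-1}(p-1)|\mathcal{I}|.\end{cases}$$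
   Context: Let $\varphi$ be Euler's totient function. For $r\ge1$, $Q_r(u)$ is the unique integer with $0\le Q_r(u)<p^r$ and $Q_r(u)\equiv \frac{u^{\varphi(p^r)}-1}{p^r}\pmod{p^r}$ if $\gcd(u,p)=1$, and $Q_r(u)=0$ if $p\mid u$. Define $H_0=Q_1$ and for $r\ge2$ let $H_{r-1}(u)\in\{0,\dots,p-1\}$ with $H_{r-1}(u)\equiv (Q_r(u)-Q_{r-1}(u))/p^{r-1}\pmod p$ (well defined since $Q_r\equiv Q_{r-1}\pmod{p^{r-1}}$); it is the highest $p$-adic digit of $Q_r(u)$. For $0\le l<p$, $D_l=\{u:0\le u<p^{r+1},\ \gcd(u,p)=1,\ H_{r-1}(u)=l\}$. The linear complexity over $\mathbb{F}_2$ of a periodic binary sequence is the least order $L$ of a linear recurrence $s(u+L)=c_{L-1}s(u+L-1)+\dots+c_0s(u)$ ($u\ge0$, $c_i\in\mathbb{F}_2$, $c_0\neq 0$) it satisfies (0 for the zero sequence). For $k\ge0$, the $k$-error linear complexity $LC_k^{\mathbb{F}_2}$ of a $T$-periodic sequence is the smallest linear complexity obtainable by changing at most $k$ terms per period (changes repeated periodically). -}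

module Defs where

open import Data.Nat using (ℕ; zero; suc; _+_; _*_; _∸_; _^_; _≤_; _<_; NonZero)
open import Data.Nat.Base using (_/_; _%_)
open import Data.Nat.DivMod using (_mod_)
open import Data.Nat.Divisibility using (_∣_; _∣?_)
open import Data.Nat.Properties using (m^n≢0)
open import Data.Nat.Coprimality using (Coprime; coprime?)
open import Data.Fin using (Fin)
import Data.Fin as Fin
open import Data.Fin.Subset using (Subset; _∈_)
open import Data.Fin.Subset.Properties using (_∈?_)
open import Data.Bool using (Bool; true; false; _xor_; _∧_; if_then_else_)
open import Data.Product using (Σ; ∃; _×_)
open import Data.Unit using (⊤)
open import Data.Empty using (⊥)
open import Relation.Nullary using (¬_; does)
open import Relation.Binary.PropositionalEquality using (_≡_)

totientUpTo : ℕ → ℕ → ℕ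
totientUpTo n zero    = 0
totientUpTo n (suc m) =
  (if does (coprime? (suc m) n) then 1 else 0) + totientUpTo n m

φ : ℕ → ℕ
φ n = totientUpTo n n

IsPrimitiveRoot : ℕ → ℕ → Set
IsPrimitiveRoot g n =
  Coprime g n × (n ∣ (g ^ φ n ∸ 1)) ×
  (∀ j → 0 < j → j < φ n → ¬ (n ∣ (g ^ j ∸ 1)))

Q : (p : ℕ) .{{_ : NonZero p}} → ℕ → ℕ → ℕ
Q p r u with does (p ∣? u)
... | true  = 0
... | false =
  ((((u ^ φ (p ^ r)) ∸ 1) / (p ^ r)) {{m^n≢0 p r}} % (p ^ r)) {{m^n≢0 p r}}

-- H p r u = H_{r-1}(u) = (Q_r(u) - Q_{r-1}(u)) / p^{r-1} mod p  (for r ≥ 2)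
H : (p : ℕ) .{{_ : NonZero p}} → ℕ → ℕ → Fin p
H p r u = (((Q p r u ∸ Q p (r ∸ 1) u) / (p ^ (r ∸ 1))) {{m^n≢0 p (r ∸ 1)}}) mod p

InD : (p : ℕ) .{{_ : NonZero p}} → (r : ℕ) → Fin p → ℕ → Set
InD p r l u = u < p ^ (r + 1) × Coprime u p × H p r u ≡ l

fseq : (p : ℕ) .{{_ : NonZero p}} → (r : ℕ) → Subset p → ℕ → Bool
fseq p r I u =
  let v = (u % (p ^ (r + 1))) {{m^n≢0 p (r + 1)}} in
  does (coprime? v p) ∧ does (H p r v ∈? I)

-- Linear complexity over F₂ (F₂ = Bool, + = xor, · = ∧)

recSum : (L : ℕ) → (Fin L → Bool) → (ℕ → Bool) → ℕ → Bool
recSum zero    c s u = false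
recSum (suc L) c s u = (c Fin.zero ∧ s u) xor recSum L (λ i → c (Fin.suc i)) s (suc u)

LeadOK : (L : ℕ) → (Fin L → Bool) → Set
LeadOK zero    c = ⊤
LeadOK (suc L) c = c Fin.zero ≡ true

HasRecurrence : (ℕ → Bool) → ℕ → Set
HasRecurrence s L =
  Σ (Fin L → Bool) λ c → LeadOK L c × (∀ u → s (u + L) ≡ recSum L c s u)

IsLinearComplexity : (ℕ → Bool) → ℕ → Set
IsLinearComplexity s L =
  HasRecurrence s L × (∀ L′ → HasRecurrence s L′ → L ≤ L′)

Periodic : ℕ → (ℕ → Bool) → Set
Periodic T s = ∀ u → s (u + T) ≡ s u

hamming : ℕ → (ℕ → Bool) → (ℕ → Bool) → ℕ
hamming zero    s t = 0
hamming (suc n) s t = (if s n xor t n then 1 else 0) + hamming n s t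

IsKErrorLC : (T k : ℕ) → (ℕ → Bool) → ℕ → Set
IsKErrorLC T k s L =
  (Σ (ℕ → Bool) λ t → Periodic T t × hamming T s t ≤ k × IsLinearComplexity t L) ×
  (∀ t L′ → Periodic T t → hamming T s t ≤ k → IsLinearComplexity t L′ → L ≤ L′)

{-# OPTIONS --safe #-}

-- Over 𝔽₂ the annihilator of a sequence is stable under C(X) ↦ C(X²), hence, for a sequence of
-- period pⁿ, under X ↦ Xᵃ for every a that is a power of 2 modulo pⁿ.  Summing Σ cᵢ s(u + a i) over
-- suitable such a (all units when n = 1, the kernel of reduction modulo pⁿ⁻¹ otherwise) shows that a
-- polynomial of degree < pⁿ killing a nonzero s with Φ_{pⁿ}(E) s = 0, E being the shift, has coefficients
-- constant on the classes modulo pⁿ⁻¹, i.e. is a multiple of Φ_{pⁿ}.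
-- With q = pʳ, n = r + 1 and D = (p − 1) q = deg Φ_{pⁿ}, a recurrence of order L for t thus either makes t
-- q-periodic or gives one of order L − D for the folded sequence g(u) = Σ_{j<p} t(u + j q).
-- The top digit H takes every value once on each class {v + j q : j < p} of units.  So f has |I|
-- ones in each class of units, which puts q-periodic sequences at distance at least p^{r-1}(p − 1)|I|,
-- and g is 0 for |I| even, the indicator of the units for |I| odd; the remaining thresholds are the
-- distances from that indicator to the constant sequences 1 and 0.
module Submission where

open import Defs
open import Algebra.Structures using (IsCommutativeMonoid)
open import Data.Bool using (Bool; true; false; if_then_else_; not; _xor_; _∧_)
open import Data.Bool.Properties
  using (xor-assoc; xor-comm; xor-identity; xor-identityʳ; xor-same; not-involutive; ¬-not;
         ∧-assoc; ∧-comm; ∧-idem; ∧-identityʳ; ∧-zeroʳ; ∧-distribˡ-xor)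
import Data.Bool.Properties as Bool
open import Data.Fin using (Fin; toℕ; fromℕ<; punchOut)
import Data.Fin as Fin
import Data.Fin.Properties as Finₚ
open import Data.Fin.Subset using (Subset; ∣_∣)
open import Data.Fin.Subset.Properties using (_∈?_)
open import Data.Nat
open import Data.Nat.Coprimality using (Coprime; coprime?; coprime-divisor)
open import Data.Nat.DivMod
open import Data.Nat.Divisibility
open import Data.Nat.Primality using (Prime; euclidsLemma; prime⇒nonTrivial; prime⇒irreducible)
open import Data.Nat.Properties
open import Data.Nat.Tactic.RingSolver using (solve-∀)
open import Data.Product using (∃; _×_; _,_; proj₁; proj₂)
open import Data.Sum using (_⊎_; inj₁; inj₂; [_,_]′)
open import Data.Vec using ([]; _∷_)
open import Function using (_∘_)
open import Relation.Binary.Definitions using (tri<; tri≈; tri>)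
open import Relation.Binary.PropositionalEquality hiding ([_])
open import Relation.Nullary using (yes; no; does; contradiction)
open import Relation.Nullary.Decidable using (dec-true; dec-false)

-- Finite sums

-- Rigidity takes the place of irreducibility: 2 generates the units modulo every pⁿ, so Φ_{pⁿ} is
-- irreducible over 𝔽₂ and must divide each polynomial that kills a nonzero s with Φ_{pⁿ}(E) s = 0.
-- The elementary form needs no division: pⁿ coefficients that repeat with period q form Φ_{pⁿ}
-- times any one of their blocks of length q, so the quotient is read off. The p - 1 in the largest
-- value comes from repeating the dichotomy at lower levels. The fold g has period q, and deg Φ_{pⁱ}
-- ≥ p - 1 for every i ≥ 1; a polynomial of degree below p - 1 that kills g therefore divides its
-- period by p again and again, until g is constant. Errors are counted on g as well: flipping one
-- term of t flips one of the q values of g, and the first q terms meet every class once, so the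
-- cheapest way to change g costs as many errors as values changed. The passage to a q-periodic
-- sequence is counted on f itself, where |I| ≤ (p - 1)/2 makes 0 the cheapest constant on a class
-- of units.

InjectiveBelow : ℕ → (ℕ → ℕ) → Set
InjectiveBelow n π = ∀ i j → i < n → j < n → π i ≡ π j → i ≡ j

-- A missed value could be punched out, which would inject `Fin (suc m)` into `Fin m`.
injectiveBelow⇒surjectiveBelow : ∀ n (π : ℕ → ℕ) → (∀ i → i < n → π i < n) →
  InjectiveBelow n π → ∀ k → k < n → ∃ λ i → i < n × π i ≡ k
injectiveBelow⇒surjectiveBelow zero π bd inj k ()
injectiveBelow⇒surjectiveBelow n@(suc m) π bd inj k k<n
  with Finₚ.any? (λ i → fromℕ< (bd (toℕ i) (Finₚ.toℕ<n i)) Finₚ.≟ fromℕ< k<n)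
... | yes (i , eq) = toℕ i , Finₚ.toℕ<n i ,
  trans (sym (Finₚ.toℕ-fromℕ< _)) (trans (cong toℕ eq) (Finₚ.toℕ-fromℕ< k<n))
... | no ¬hit = contradiction (Finₚ.injective⇒≤ avoid-injective) 1+n≰n
  where
  f : Fin n → Fin n
  f i = fromℕ< (bd (toℕ i) (Finₚ.toℕ<n i))

  avoid : Fin n → Fin m
  avoid i = punchOut {i = fromℕ< k<n} {j = f i} (λ e → ¬hit (i , sym e))

  avoid-injective : ∀ {i j} → avoid i ≡ avoid j → i ≡ j
  avoid-injective {i} {j} e = Finₚ.toℕ-injective (inj _ _ (Finₚ.toℕ<n i) (Finₚ.toℕ<n j)
    (trans (sym (Finₚ.toℕ-fromℕ< _))
      (trans (cong toℕ (Finₚ.punchOut-injective {i = fromℕ< k<n} _ _ e)) (Finₚ.toℕ-fromℕ< _))))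

-- Stated for a commutative monoid because it serves twice: with `_+_` for counting ones and with
-- `_xor_` for identities over 𝔽₂.
module Summation {A : Set} (_∙_ : A → A → A) (ε : A)
  (isCM : IsCommutativeMonoid _≡_ _∙_ ε) where

  open IsCommutativeMonoid isCM using (assoc; comm; identityˡ; identityʳ)

  sum : ℕ → (ℕ → A) → A
  sum zero    f = ε
  sum (suc n) f = f n ∙ sum n f

  interchange : ∀ a b c d → (a ∙ b) ∙ (c ∙ d) ≡ (a ∙ c) ∙ (b ∙ d)
  interchange a b c d = begin
    (a ∙ b) ∙ (c ∙ d) ≡⟨ assoc a b (c ∙ d) ⟩
    a ∙ (b ∙ (c ∙ d)) ≡⟨ cong (a ∙_) (assoc b c d) ⟨
    a ∙ ((b ∙ c) ∙ d) ≡⟨ cong (λ x → a ∙ (x ∙ d)) (comm b c) ⟩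
    a ∙ ((c ∙ b) ∙ d) ≡⟨ cong (a ∙_) (assoc c b d) ⟩
    a ∙ (c ∙ (b ∙ d)) ≡⟨ assoc a c (b ∙ d) ⟨
    (a ∙ c) ∙ (b ∙ d) ∎
    where open ≡-Reasoning

  sum-cong-< : ∀ n {f g : ℕ → A} → (∀ i → i < n → f i ≡ g i) → sum n f ≡ sum n g
  sum-cong-< zero    f≗g = refl
  sum-cong-< (suc n) f≗g =
    cong₂ _∙_ (f≗g n ≤-refl) (sum-cong-< n λ i i<n → f≗g i (m≤n⇒m≤1+n i<n))

  sum-cong : ∀ n {f g : ℕ → A} → (∀ i → f i ≡ g i) → sum n f ≡ sum n g
  sum-cong n f≗g = sum-cong-< n λ i _ → f≗g i

  sum-ε : ∀ n {f : ℕ → A} → (∀ i → i < n → f i ≡ ε) → sum n f ≡ ε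
  sum-ε zero    f≗ε = refl
  sum-ε (suc n) f≗ε =
    trans (cong₂ _∙_ (f≗ε n ≤-refl) (sum-ε n λ i i<n → f≗ε i (m≤n⇒m≤1+n i<n))) (identityˡ ε)

  sum-∙ : ∀ n (f g : ℕ → A) → sum n (λ i → f i ∙ g i) ≡ sum n f ∙ sum n g
  sum-∙ zero    f g = sym (identityˡ ε)
  sum-∙ (suc n) f g =
    trans (cong ((f n ∙ g n) ∙_) (sum-∙ n f g)) (interchange (f n) (g n) (sum n f) (sum n g))

  sum-swap : ∀ m n (f : ℕ → ℕ → A) →
    sum m (λ i → sum n (f i)) ≡ sum n (λ j → sum m (λ i → f i j))
  sum-swap zero    n f = sym (sum-ε n λ _ _ → refl)
  sum-swap (suc m) n f =
    trans (cong (sum n (f m) ∙_) (sum-swap m n f)) (sym (sum-∙ n (f m) _))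

  sum-first : ∀ n (f : ℕ → A) → sum (suc n) f ≡ f 0 ∙ sum n (λ i → f (suc i))
  sum-first zero    f = refl
  sum-first (suc n) f = begin
    f (suc n) ∙ sum (suc n) f          ≡⟨ cong (f (suc n) ∙_) (sum-first n f) ⟩
    f (suc n) ∙ (f 0 ∙ rest)           ≡⟨ assoc _ _ _ ⟨
    (f (suc n) ∙ f 0) ∙ rest           ≡⟨ cong (_∙ rest) (comm _ _) ⟩
    (f 0 ∙ f (suc n)) ∙ rest           ≡⟨ assoc _ _ _ ⟩
    f 0 ∙ (f (suc n) ∙ rest)           ∎
    where
    open ≡-Reasoning
    rest : A
    rest = sum n (λ i → f (suc i))

  sum-+ : ∀ m n (f : ℕ → A) → sum (m + n) f ≡ sum m (λ i → f (i + n)) ∙ sum n f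
  sum-+ zero    n f = sym (identityˡ _)
  sum-+ (suc m) n f = trans (cong (f (m + n) ∙_) (sum-+ m n f)) (sym (assoc _ _ _))

  sum-* : ∀ m n (f : ℕ → A) → sum (m * n) f ≡ sum m (λ j → sum n (λ b → f (b + j * n)))
  sum-* zero    n f = refl
  sum-* (suc m) n f =
    trans (sum-+ n (m * n) f) (cong (sum n (λ b → f (b + m * n)) ∙_) (sum-* m n f))

  sum-extend : ∀ m n (f : ℕ → A) → m ≤ n →
    (∀ i → m ≤ i → i < n → f i ≡ ε) → sum n f ≡ sum m f
  sum-extend m n f m≤n f≗ε = begin
    sum n f                                       ≡⟨ cong (λ k → sum k f) (m∸n+n≡m m≤n) ⟨
    sum (n ∸ m + m) f                             ≡⟨ sum-+ (n ∸ m) m f ⟩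
    sum (n ∸ m) (λ i → f (i + m)) ∙ sum m f       ≡⟨ cong (_∙ sum m f)
                                                       (sum-ε (n ∸ m) λ i i<n∸m → f≗ε _ (m≤n+m m i)
                                                         (subst (i + m <_) (m∸n+n≡m m≤n) (+-monoˡ-< m i<n∸m))) ⟩
    ε ∙ sum m f                                   ≡⟨ identityˡ _ ⟩
    sum m f                                       ∎
    where open ≡-Reasoning

  sum-single : ∀ n k (f : ℕ → A) → k < n → (∀ i → i < n → i ≢ k → f i ≡ ε) → sum n f ≡ f k
  sum-single (suc n) k f k<n off with k ≟ n
  ... | yes refl = trans
    (cong (f n ∙_) (sum-ε n λ i i<n → off i (m≤n⇒m≤1+n i<n) (<⇒≢ i<n))) (identityʳ _)
  ... | no k≢n = trans (cong₂ _∙_ (off n ≤-refl (k≢n ∘ sym))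
      (sum-single n k f (≤∧≢⇒< (s≤s⁻¹ k<n) k≢n) λ i i<n → off i (m≤n⇒m≤1+n i<n)))
    (identityˡ _)

  -- Double counting of the graph of π: Σᵢ f (π i) = Σᵢ Σₖ [π i = k] f k.
  sum-reindex : ∀ n (π : ℕ → ℕ) (f : ℕ → A) → (∀ i → i < n → π i < n) →
    InjectiveBelow n π → sum n (f ∘ π) ≡ sum n f
  sum-reindex n π f bd inj = begin
    sum n (f ∘ π)                             ≡⟨ sum-cong-< n row ⟨
    sum n (λ i → sum n (entry i))             ≡⟨ sum-swap n n entry ⟩
    sum n (λ k → sum n (λ i → entry i k))     ≡⟨ sum-cong-< n column ⟩
    sum n f                                   ∎
    where
    open ≡-Reasoning
    entry : ℕ → ℕ → A
    entry i k = if does (π i ≟ k) then f k else ε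

    on : ∀ i k → π i ≡ k → entry i k ≡ f k
    on i k eq = cong (if_then f k else ε) (dec-true (π i ≟ k) eq)

    off : ∀ i k → π i ≢ k → entry i k ≡ ε
    off i k neq = cong (if_then f k else ε) (dec-false (π i ≟ k) neq)

    row : ∀ i → i < n → sum n (entry i) ≡ f (π i)
    row i i<n = trans
      (sum-single n (π i) (entry i) (bd i i<n) λ k _ k≢ → off i k (k≢ ∘ sym)) (on i (π i) refl)

    column : ∀ k → k < n → sum n (λ i → entry i k) ≡ f k
    column k k<n with injectiveBelow⇒surjectiveBelow n π bd inj k k<n
    ... | i₀ , i₀<n , eq = trans
      (sum-single n i₀ (λ i → entry i k) i₀<n λ i i<n i≢ →
        off i k λ e → i≢ (inj i i₀ i<n i₀<n (trans e (sym eq))))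
      (on i₀ k eq)

-- Powers modulo prime powers

module Σℕ = Summation _+_ 0 +-0-isCommutativeMonoid

sum-const : ∀ n c → Σℕ.sum n (λ _ → c) ≡ n * c
sum-const zero    c = refl
sum-const (suc n) c = cong (c +_) (sum-const n c)

sum-mono-≤ : ∀ n {f g : ℕ → ℕ} → (∀ i → i < n → f i ≤ g i) → Σℕ.sum n f ≤ Σℕ.sum n g
sum-mono-≤ zero    f≤g = z≤n
sum-mono-≤ (suc n) f≤g =
  +-mono-≤ (f≤g n ≤-refl) (sum-mono-≤ n λ i i<n → f≤g i (m≤n⇒m≤1+n i<n))

[_] : Bool → ℕ
[ b ] = if b then 1 else 0

-- For y < x the truncated difference is 0, so no case distinction arises.
%-≡⇒∣∸ : ∀ x y n .{{_ : NonZero n}} → x % n ≡ y % n → n ∣ y ∸ x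
%-≡⇒∣∸ x y n eq = divides (y / n ∸ x / n) (begin
  y ∸ x                                     ≡⟨ cong₂ _∸_ (m≡m%n+[m/n]*n y n) (m≡m%n+[m/n]*n x n) ⟩
  (y % n + y / n * n) ∸ (x % n + x / n * n) ≡⟨ cong (λ z → (y % n + y / n * n) ∸ (z + x / n * n)) eq ⟩
  (y % n + y / n * n) ∸ (y % n + x / n * n) ≡⟨ [m+n]∸[m+o]≡n∸o (y % n) _ _ ⟩
  y / n * n ∸ x / n * n                     ≡⟨ *-distribʳ-∸ n (y / n) (x / n) ⟨
  (y / n ∸ x / n) * n                       ∎)
  where open ≡-Reasoning

≡1+n*c⇒∣∸1 : ∀ {n c x} → x ≡ 1 + n * c → n ∣ x ∸ 1
≡1+n*c⇒∣∸1 {n} {c} refl = m∣m*n c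

opaque
  ∣∸1⇒≡1+n*c : ∀ {n x} → 1 ≤ x → n ∣ x ∸ 1 → ∃ λ c → x ≡ 1 + n * c
  ∣∸1⇒≡1+n*c {n} {suc x} _ (divides c eq) = c , cong suc (trans eq (*-comm c n))

[m+k*n]/n : ∀ m k n .{{_ : NonZero n}} → (m + k * n) / n ≡ m / n + k
[m+k*n]/n m k n = trans (+-distrib-/-∣ʳ m (n∣m*n k)) (cong (m / n +_) (m*n/n≡m k n))

-- The binomial theorem cut after the linear term; a successor as exponent keeps the derivative free
-- of subtraction.
^-first-order : ∀ a b n → ∃ λ K → (a + b) ^ suc n ≡ a ^ suc n + suc n * a ^ n * b + b * b * K
^-first-order a b zero = 0 , ring a b
  where
  ring : ∀ a b → (a + b) * 1 ≡ a * 1 + 1 * 1 * b + b * b * 0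
  ring = solve-∀
^-first-order a b (suc n) with ^-first-order a b n
... | K , eq = a * K + suc n * a ^ n + b * K ,
  trans (cong ((a + b) *_) eq) (ring a b n (a ^ n) K)
  where
  ring : ∀ a b n A K → (a + b) * (a * A + suc n * A * b + b * b * K) ≡
    a * (a * A) + suc (suc n) * (a * A) * b + b * b * (a * K + suc n * A + b * K)
  ring = solve-∀

-- The binomial coefficient n over 2.
triangle : ℕ → ℕ
triangle zero    = 0
triangle (suc n) = n + triangle n

triangle-double : ∀ n → triangle (suc n) * 2 ≡ suc n * n
triangle-double zero    = refl
triangle-double (suc n) = trans (ring n (triangle n)) (trans
  (cong (λ x → suc n * 2 + x) (triangle-double n)) (ring′ n))
  where
  ring : ∀ n t → (suc n + (n + t)) * 2 ≡ suc n * 2 + (n + t) * 2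
  ring = solve-∀
  ring′ : ∀ n → suc n * 2 + suc n * n ≡ suc (suc n) * suc n
  ring′ = solve-∀

-- The quadratic term stays separate because its coefficient at n = p is divisible by the odd prime
-- p, a factor that a remainder b²K would hide.
[1+b]^-second-order : ∀ b n → ∃ λ K →
  (1 + b) ^ n ≡ 1 + n * b + triangle n * (b * b) + b * b * b * K
[1+b]^-second-order b zero = 0 , ring b
  where
  ring : ∀ b → 1 ≡ 1 + 0 * b + 0 * (b * b) + b * b * b * 0
  ring = solve-∀
[1+b]^-second-order b (suc n) with [1+b]^-second-order b n
... | K , eq = triangle n + K + b * K ,
  trans (cong ((1 + b) *_) eq) (ring b n (triangle n) K)
  where
  ring : ∀ b n t K → (1 + b) * (1 + n * b + t * (b * b) + b * b * b * K) ≡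
    1 + suc n * b + (n + t) * (b * b) + b * b * b * (t + K + b * K)
  ring = solve-∀

-- Units modulo powers of an odd prime, and Euler's function

module OddPrime (p : ℕ) .{{_ : NonZero p}} (pr : Prime p) (p-odd : p % 2 ≡ 1) where

  1<p : 1 < p
  1<p = nonTrivial⇒n>1 p {{prime⇒nonTrivial pr}}

  p≡1+[p∸1] : p ≡ suc (p ∸ 1)
  p≡1+[p∸1] = sym (m+[n∸m]≡n (<⇒≤ 1<p))

  p∸1>0 : 0 < p ∸ 1
  p∸1>0 = m<n⇒0<n∸m 1<p

  p∸1<p : p ∸ 1 < p
  p∸1<p = ≤-reflexive (sym p≡1+[p∸1])

  p∤2 : p ∤ 2
  p∤2 p∣2 with ≤-antisym (∣⇒≤ p∣2) 1<p
  ... | refl = contradiction p-odd λ ()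

  p∤1 : p ∤ 1
  p∤1 p∣1 = <⇒≱ 1<p (∣⇒≤ p∣1)

  p∤p∸1 : p ∤ p ∸ 1
  p∤p∸1 p∣ = <⇒≱ p∸1<p (∣⇒≤ {{>-nonZero p∸1>0}} p∣)

  p∤-* : ∀ {a b} → p ∤ a → p ∤ b → p ∤ a * b
  p∤-* {a} {b} p∤a p∤b p∣ab = [ p∤a , p∤b ]′ (euclidsLemma a b pr p∣ab)

  p∤-^ : ∀ {a} n → p ∤ a → p ∤ a ^ n
  p∤-^ zero    p∤a = p∤1
  p∤-^ (suc n) p∤a = p∤-* p∤a (p∤-^ n p∤a)

  p∣triangle : p ∣ triangle p
  p∣triangle = [ (λ z → z) , (λ p∣2 → contradiction p∣2 p∤2) ]′
    (euclidsLemma (triangle p) 2 pr (subst (λ x → x ∣ triangle x * 2) (sym p≡1+[p∸1])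
      (subst (suc (p ∸ 1) ∣_) (sym (triangle-double (p ∸ 1))) (m∣m*n (p ∸ 1)))))

  opaque
    -- Since p divides the binomial coefficient p over 2, all terms past the linear one carry
    -- p^(m+1) on top of p^(m+2). Lifting thus changes the quotient c only by a multiple of p^(m+1):
    -- its residue modulo p survives, and so do the low digits of the Euler quotient.
    [1+p^m*c]^p : ∀ m c → ∃ λ z →
      (1 + p ^ suc m * c) ^ p ≡ 1 + p ^ suc (suc m) * (c + p ^ suc m * z)
    [1+p^m*c]^p m c with p∣triangle | [1+b]^-second-order (p ^ suc m * c) p
    ... | divides τ τ-eq | K , eq = τ * (c * c) + p ^ m * (c * c * c * K) ,
      trans eq (trans (cong (λ t → 1 + p * b + t * (b * b) + b * b * b * K) τ-eq)
        (ring p (p ^ m) c τ K))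
      where
      b : ℕ
      b = p ^ suc m * c
      ring : ∀ p P c τ K → 1 + p * (p * P * c) + τ * p * (p * P * c * (p * P * c))
          + p * P * c * (p * P * c) * (p * P * c) * K ≡
        1 + p * (p * P) * (c + p * P * (τ * (c * c) + P * (c * c * c * K)))
      ring = solve-∀

  unit : ℕ → Bool
  unit v = not (does (p ∣? v))

  unit-true : ∀ {v} → p ∤ v → unit v ≡ true
  unit-true {v} p∤v = cong not (dec-false (p ∣? v) p∤v)

  unit-false : ∀ {v} → p ∣ v → unit v ≡ false
  unit-false {v} p∣v = cong not (dec-true (p ∣? v) p∣v)

  p∤⇒coprime : ∀ {v} → p ∤ v → Coprime v p
  p∤⇒coprime p∤v (d∣v , d∣p) with prime⇒irreducible pr d∣p
  ... | inj₁ d≡1  = d≡1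
  ... | inj₂ refl = contradiction d∣v p∤v

  coprime-^ : ∀ {v} m → p ∤ v → Coprime v (p ^ m)
  coprime-^ zero    p∤v (_ , d∣1) = ∣1⇒≡1 d∣1
  coprime-^ (suc m) p∤v {d} (d∣v , d∣p^) =
    coprime-^ m p∤v (d∣v , coprime-divisor
      (λ (e∣d , e∣p) → p∤⇒coprime p∤v (∣-trans e∣d d∣v , e∣p)) d∣p^)

  coprime?-^ : ∀ v m → does (coprime? v (p ^ suc m)) ≡ unit v
  coprime?-^ v m with p ∣? v
  ... | yes p∣v = dec-false (coprime? v (p ^ suc m)) λ cop →
    p∤1 (subst (p ∣_) (cop (p∣v , m∣m*n (p ^ m))) ∣-refl)
  ... | no p∤v = dec-true (coprime? v (p ^ suc m)) (coprime-^ (suc m) p∤v)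

  coprime?-p : ∀ v → does (coprime? v p) ≡ unit v
  coprime?-p v = trans (cong (λ x → does (coprime? v x)) (sym (*-identityʳ p))) (coprime?-^ v 0)

  p∣-+* : ∀ b j → p ∣ b + j * p → p ∣ b
  p∣-+* b j p∣ = ∣m+n∣m⇒∣n (subst (p ∣_) (+-comm b (j * p)) p∣) (n∣m*n j)

  unit-+* : ∀ b j → unit (b + j * p) ≡ unit b
  unit-+* b j with p ∣? b
  ... | yes p∣b = unit-false (∣m∣n⇒∣m+n p∣b (n∣m*n j))
  ... | no p∤b  = unit-true (p∤b ∘ p∣-+* b j)

  count-units-p : Σℕ.sum p ([_] ∘ unit) ≡ p ∸ 1
  count-units-p = begin
    Σℕ.sum p ([_] ∘ unit)                                   ≡⟨ cong (λ n → Σℕ.sum n ([_] ∘ unit)) p≡1+[p∸1] ⟩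
    Σℕ.sum (suc (p ∸ 1)) ([_] ∘ unit)                       ≡⟨ Σℕ.sum-first (p ∸ 1) _ ⟩
    [ unit 0 ] + Σℕ.sum (p ∸ 1) (λ i → [ unit (suc i) ])    ≡⟨ cong₂ _+_ (cong [_] (unit-false (p ∣0)))
      (Σℕ.sum-cong-< (p ∸ 1) λ i i<p∸1 → cong [_] (unit-true (>⇒∤
        (subst (suc i <_) (sym p≡1+[p∸1]) (s≤s i<p∸1))))) ⟩
    Σℕ.sum (p ∸ 1) (λ _ → 1)                                ≡⟨ sum-const (p ∸ 1) 1 ⟩
    (p ∸ 1) * 1                                             ≡⟨ *-identityʳ _ ⟩
    p ∸ 1                                                   ∎
    where open ≡-Reasoning

  count-units : ∀ m → Σℕ.sum (p ^ suc m) ([_] ∘ unit) ≡ p ^ m * (p ∸ 1)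
  count-units m = begin
    Σℕ.sum (p ^ suc m) ([_] ∘ unit)                                ≡⟨ cong (λ n → Σℕ.sum n ([_] ∘ unit)) (*-comm p (p ^ m)) ⟩
    Σℕ.sum (p ^ m * p) ([_] ∘ unit)                                ≡⟨ Σℕ.sum-* (p ^ m) p _ ⟩
    Σℕ.sum (p ^ m) (λ j → Σℕ.sum p (λ b → [ unit (b + j * p) ]))   ≡⟨ Σℕ.sum-cong (p ^ m) (λ j →
      trans (Σℕ.sum-cong p λ b → cong [_] (unit-+* b j)) count-units-p) ⟩
    Σℕ.sum (p ^ m) (λ _ → p ∸ 1)                                   ≡⟨ sum-const (p ^ m) (p ∸ 1) ⟩
    p ^ m * (p ∸ 1)                                                ∎
    where open ≡-Reasoning

  totientUpTo-sum : ∀ m n → totientUpTo (p ^ suc m) n ≡ Σℕ.sum n (λ i → [ unit (suc i) ])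
  totientUpTo-sum m zero    = refl
  totientUpTo-sum m (suc n) = cong₂ (λ b x → [ b ] + x) (coprime?-^ (suc n) m) (totientUpTo-sum m n)

  φ-prime-power : ∀ m → φ (p ^ suc m) ≡ p ^ m * (p ∸ 1)
  φ-prime-power m = begin
    φ N                                            ≡⟨ totientUpTo-sum m N ⟩
    -- `totientUpTo` counts 1, ..., N and `sum` counts 0, ..., N - 1; both 0 and N are multiples of
    -- p, so the two counts agree.
    Σℕ.sum N (λ i → [ unit (suc i) ])              ≡⟨ cong (λ b → [ b ] + Σℕ.sum N (λ i → [ unit (suc i) ])) (unit-false (p ∣0)) ⟨
    [ unit 0 ] + Σℕ.sum N (λ i → [ unit (suc i) ]) ≡⟨ Σℕ.sum-first N _ ⟨
    [ unit N ] + Σℕ.sum N ([_] ∘ unit)             ≡⟨ cong (λ b → [ b ] + Σℕ.sum N ([_] ∘ unit)) (unit-false (m∣m*n (p ^ m))) ⟩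
    Σℕ.sum N ([_] ∘ unit)                          ≡⟨ count-units m ⟩
    p ^ m * (p ∸ 1)                                ∎
    where
    open ≡-Reasoning
    N : ℕ
    N = p ^ suc m

%-cong-* : ∀ {a b c d} n .{{_ : NonZero n}} → a % n ≡ b % n → c % n ≡ d % n →
  (a * c) % n ≡ (b * d) % n
%-cong-* {a} {b} {c} {d} n eq eq′ = trans (%-distribˡ-* a c n)
  (trans (cong₂ (λ x y → (x * y) % n) eq eq′) (sym (%-distribˡ-* b d n)))

%-cong-^ : ∀ {a b} k n .{{_ : NonZero n}} → a % n ≡ b % n → (a ^ k) % n ≡ (b ^ k) % n
%-cong-^ zero    n eq = refl
%-cong-^ (suc k) n eq = %-cong-* n eq (%-cong-^ k n eq)

-- Powers of 2 modulo powers of p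

module PrimitiveRoot (p : ℕ) .{{_ : NonZero p}} (pr : Prime p) (p-odd : p % 2 ≡ 1)
  (primitive-root : IsPrimitiveRoot 2 (p ^ 2)) where

  open OddPrime p pr p-odd public

  φ[p²] : φ (p ^ 2) ≡ (p ∸ 1) * p
  φ[p²] = trans (φ-prime-power 1) (trans (cong (_* (p ∸ 1)) (*-identityʳ p)) (*-comm p (p ∸ 1)))

  2^j≢1-mod-p² : ∀ j → 0 < j → j < (p ∸ 1) * p → p ^ 2 ∤ 2 ^ j ∸ 1
  2^j≢1-mod-p² j 0<j j< =
    proj₂ (proj₂ primitive-root) j 0<j (subst (j <_) (sym φ[p²]) j<)

  opaque
    -- A p-th power lifts 2^i ≡ 1 from p to p², where the exponent i p is still below φ(p²) = (p -
    -- 1) p.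
    2^i≢1-mod-p : ∀ i → 0 < i → i < p ∸ 1 → p ∤ 2 ^ i ∸ 1
    2^i≢1-mod-p i 0<i i<p∸1 p∣ = 2^j≢1-mod-p² (i * p) (*-mono-< 0<i (>-nonZero⁻¹ p)) (*-monoˡ-< p i<p∸1)
      (raise (∣∸1⇒≡1+n*c {p ^ 1} {2 ^ i} (m^n>0 2 i) (subst (_∣ 2 ^ i ∸ 1) (sym (*-identityʳ p)) p∣)))
      where
      raise : (∃ λ c → 2 ^ i ≡ 1 + p ^ 1 * c) → p ^ 2 ∣ 2 ^ (i * p) ∸ 1
      raise (c , eq) with [1+p^m*c]^p 0 c
      ... | z , eq′ = ≡1+n*c⇒∣∸1 {p ^ 2} {c + p ^ 1 * z} {2 ^ (i * p)}
        (trans (sym (^-*-assoc 2 i p)) (trans (cong (_^ p) eq) eq′))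

  opaque
    p∤2^ : ∀ i → p ∤ 2 ^ i
    p∤2^ i = p∤-^ i p∤2

  opaque
    2^i≡2^j⇒2^[j∸i]≡1 : ∀ i j → i < j → 2 ^ i % p ≡ 2 ^ j % p → p ∣ 2 ^ (j ∸ i) ∸ 1
    2^i≡2^j⇒2^[j∸i]≡1 i j i<j eq = [ (λ p∣ → contradiction p∣ (p∤2^ i)) , (λ p∣ → p∣ ) ]′
      (euclidsLemma (2 ^ i) _ pr (subst (p ∣_) factor (%-≡⇒∣∸ (2 ^ i) (2 ^ j) p eq)))
      where
      open ≡-Reasoning
      factor : 2 ^ j ∸ 2 ^ i ≡ 2 ^ i * (2 ^ (j ∸ i) ∸ 1)
      factor = begin
        2 ^ j ∸ 2 ^ i                       ≡⟨ cong (λ k → 2 ^ k ∸ 2 ^ i) (m+[n∸m]≡n (<⇒≤ i<j)) ⟨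
        2 ^ (i + (j ∸ i)) ∸ 2 ^ i           ≡⟨ cong₂ _∸_ (^-distribˡ-+-* 2 i (j ∸ i)) (sym (*-identityʳ (2 ^ i))) ⟩
        2 ^ i * 2 ^ (j ∸ i) ∸ 2 ^ i * 1     ≡⟨ *-distribˡ-∸ (2 ^ i) _ 1 ⟨
        2 ^ i * (2 ^ (j ∸ i) ∸ 1)           ∎

  2^i%p>0 : ∀ i → 0 < 2 ^ i % p
  2^i%p>0 i = n≢0⇒n>0 (p∤2^ i ∘ m%n≡0⇒n∣m (2 ^ i) p)

  opaque
    -- Pigeonhole: the p powers 2⁰, ..., 2^(p-1) take only p - 1 nonzero residues, shifted down by 1
    -- to fit `Fin (p ∸ 1)`. A collision has exponent difference at most p - 1, and a smaller
    -- difference is excluded by the order of 2.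
    p∣2^[p∸1]∸1 : p ∣ 2 ^ (p ∸ 1) ∸ 1
    p∣2^[p∸1]∸1 with Finₚ.pigeonhole p∸1<p
      (λ (i : Fin p) → fromℕ< {2 ^ toℕ i % p ∸ 1} (∸-monoˡ-< (m%n<n (2 ^ toℕ i) p) (2^i%p>0 (toℕ i))))
    ... | i , j , i<j , eq = subst (λ k → p ∣ 2 ^ k ∸ 1) full
      (2^i≡2^j⇒2^[j∸i]≡1 (toℕ i) (toℕ j) i<j same)
      where
      d : ℕ
      d = toℕ j ∸ toℕ i
      same : 2 ^ toℕ i % p ≡ 2 ^ toℕ j % p
      same = ∸-cancelʳ-≡ (2^i%p>0 (toℕ i)) (2^i%p>0 (toℕ j))
        (trans (sym (Finₚ.toℕ-fromℕ< _)) (trans (cong toℕ eq) (Finₚ.toℕ-fromℕ< _)))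
      d≤p∸1 : d ≤ p ∸ 1
      d≤p∸1 = ≤-trans (m∸n≤m (toℕ j) (toℕ i)) (<⇒≤pred (Finₚ.toℕ<n j))
      full : d ≡ p ∸ 1
      full with d ≟ p ∸ 1
      ... | yes d≡ = d≡
      ... | no d≢ = contradiction (2^i≡2^j⇒2^[j∸i]≡1 (toℕ i) (toℕ j) i<j same)
        (2^i≢1-mod-p d (m<n⇒0<n∸m i<j) (≤∧≢⇒< d≤p∸1 d≢))

  opaque
    -- The residue 0 followed by 2⁰, ..., 2^(p-2) is an injective list of p residues, hence contains
    -- them all.
    units-are-powers-of-2 : ∀ a → p ∤ a → ∃ λ j → 2 ^ j % p ≡ a % p
    units-are-powers-of-2 a p∤a with injectiveBelow⇒surjectiveBelow p π π<p π-injective (a % p) (m%n<n a p)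
      where
      π : ℕ → ℕ
      π zero    = 0
      π (suc j) = 2 ^ j % p
      π<p : ∀ i → i < p → π i < p
      π<p zero    _ = >-nonZero⁻¹ p
      π<p (suc j) _ = m%n<n (2 ^ j) p
      distinct : ∀ i j → suc j < p → i < j → 2 ^ i % p ≢ 2 ^ j % p
      distinct i j j<p i<j eq = 2^i≢1-mod-p (j ∸ i) (m<n⇒0<n∸m i<j)
        (≤-<-trans (m∸n≤m j i) (∸-monoˡ-≤ 1 j<p)) (2^i≡2^j⇒2^[j∸i]≡1 i j i<j eq)
      π-injective : InjectiveBelow p π
      π-injective zero    zero    _ _ _ = refl
      π-injective zero    (suc j) _ _ eq = contradiction eq (<⇒≢ (2^i%p>0 j))
      π-injective (suc i) zero    _ _ eq = contradiction (sym eq) (<⇒≢ (2^i%p>0 i))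
      π-injective (suc i) (suc j) i< j< eq with <-cmp i j
      ... | tri< i<j _ _ = contradiction eq (distinct i j j< i<j)
      ... | tri≈ _ i≡j _ = cong suc i≡j
      ... | tri> _ _ j<i = contradiction (sym eq) (distinct j i i< j<i)
    ... | zero  , _ , eq = contradiction (m%n≡0⇒n∣m a p (sym eq)) p∤a
    ... | suc j , _ , eq = j , eq

  opaque
    -- As u ≡ 2^j modulo p, this is the j-th power of the congruence for 2.
    fermat : ∀ u → p ∤ u → ∃ λ c → u ^ (p ∸ 1) ≡ 1 + p ^ 1 * c
    fermat u p∤u with units-are-powers-of-2 u p∤u
    ... | j , 2^j≡u = ∣∸1⇒≡1+n*c (n≢0⇒n>0 λ eq → p∤-^ (p ∸ 1) p∤u (subst (p ∣_) (sym eq) (p ∣0)))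
      (subst (_∣ u ^ (p ∸ 1) ∸ 1) (sym (*-identityʳ p)) (%-≡⇒∣∸ 1 (u ^ (p ∸ 1)) p (begin
        1 % p                     ≡⟨ cong (_% p) (^-zeroˡ j) ⟨
        (1 ^ j) % p               ≡⟨ %-cong-^ j p 2^[p∸1]≡1 ⟨
        ((2 ^ (p ∸ 1)) ^ j) % p   ≡⟨ cong (_% p) (trans (^-*-assoc 2 (p ∸ 1) j)
                                       (trans (cong (2 ^_) (*-comm (p ∸ 1) j)) (sym (^-*-assoc 2 j (p ∸ 1))))) ⟩
        ((2 ^ j) ^ (p ∸ 1)) % p   ≡⟨ %-cong-^ (p ∸ 1) p 2^j≡u ⟩
        (u ^ (p ∸ 1)) % p         ∎)))
      where
      open ≡-Reasoning
      2^[p∸1]≡1 : 2 ^ (p ∸ 1) % p ≡ 1 % p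
      2^[p∸1]≡1 with ∣∸1⇒≡1+n*c {p} (m^n>0 2 (p ∸ 1)) p∣2^[p∸1]∸1
      ... | c , eq = trans (cong (_% p) (trans eq (cong suc (*-comm p c)))) ([m+kn]%n≡m%n 1 c p)

  opaque
    ^-raise : ∀ x m c → x ^ (p ^ m * (p ∸ 1)) ≡ 1 + p ^ suc m * c → ∃ λ z →
      x ^ (p ^ suc m * (p ∸ 1)) ≡ 1 + p ^ suc (suc m) * (c + p ^ suc m * z)
    ^-raise x m c eq with [1+p^m*c]^p m c
    ... | z , eq′ = z , trans (cong (x ^_) (ring p (p ^ m) (p ∸ 1)))
      (trans (sym (^-*-assoc x (p ^ m * (p ∸ 1)) p)) (trans (cong (_^ p) eq) eq′))
      where
      ring : ∀ p P k → p * P * k ≡ P * k * p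
      ring = solve-∀

  opaque
    -- 2 stays a primitive root modulo every power of p.
    2^φ-exact : ∀ m → ∃ λ c → p ∤ c × 2 ^ (p ^ m * (p ∸ 1)) ≡ 1 + p ^ suc m * c
    2^φ-exact zero with fermat 2 p∤2
    ... | c , eq = c , p∤c , trans (cong (2 ^_) (*-identityˡ (p ∸ 1))) eq
      where
      -- Here the modulus p² enters: p ∣ c would give 2^(p-1) ≡ 1 modulo p², although p - 1 < φ(p²).
      p∤c : p ∤ c
      p∤c (divides k c≡) = 2^j≢1-mod-p² (p ∸ 1) p∸1>0
        (subst (_< (p ∸ 1) * p) (*-identityʳ (p ∸ 1)) (*-monoʳ-< (p ∸ 1) {{>-nonZero p∸1>0}} 1<p))
        (≡1+n*c⇒∣∸1 {p ^ 2} {k} (trans eq (cong suc (trans (cong (p ^ 1 *_) c≡) (ring p k)))))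
        where
        ring : ∀ p k → p * 1 * (k * p) ≡ p * (p * 1) * k
        ring = solve-∀
    2^φ-exact (suc m) with 2^φ-exact m
    ... | c , p∤c , eq with ^-raise 2 m c eq
    ... | z , eq′ = c + p ^ suc m * z ,
      (λ p∣ → p∤c (∣m+n∣m⇒∣n (subst (p ∣_) (+-comm c _) p∣) (∣m⇒∣m*n z (m∣m*n (p ^ m))))) , eq′

  opaque
    euler : ∀ u → p ∤ u → ∀ m → ∃ λ c → u ^ (p ^ m * (p ∸ 1)) ≡ 1 + p ^ suc m * c
    euler u p∤u zero with fermat u p∤u
    ... | c , eq = c , trans (cong (u ^_) (*-identityˡ (p ∸ 1))) eq
    euler u p∤u (suc m) with euler u p∤u m
    ... | c , eq = _ , proj₂ (^-raise u m c eq)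

  -- Euler quotients and their top digit

  Q-value : ∀ u m c → p ∤ u → u ^ (p ^ m * (p ∸ 1)) ≡ 1 + p ^ suc m * c →
    Q p (suc m) u ≡ (c % p ^ suc m) {{m^n≢0 p (suc m)}}
  Q-value u m c p∤u eq with p ∣? u
  ... | yes p∣u = contradiction p∣u p∤u
  ... | no _ = cong (λ x → (x % p ^ suc m) {{p^≢0}}) (begin
      ((u ^ φ (p ^ suc m) ∸ 1) / p ^ suc m) {{p^≢0}}
        ≡⟨ cong (λ e → ((u ^ e ∸ 1) / p ^ suc m) {{p^≢0}}) (φ-prime-power m) ⟩
      ((u ^ (p ^ m * (p ∸ 1)) ∸ 1) / p ^ suc m) {{p^≢0}}
        ≡⟨ cong (λ x → ((x ∸ 1) / p ^ suc m) {{p^≢0}}) (trans eq (cong suc (*-comm (p ^ suc m) c))) ⟩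
      ((c * p ^ suc m) / p ^ suc m) {{p^≢0}}
        ≡⟨ m*n/n≡m c (p ^ suc m) {{p^≢0}} ⟩
      c ∎)
    where
    open ≡-Reasoning
    p^≢0 : NonZero (p ^ suc m)
    p^≢0 = m^n≢0 p (suc m)

  -- The quotients of two consecutive levels agree modulo B, so the truncated subtraction loses
  -- nothing: it leaves k B, with k the digit of c + B z at place B.
  top-digit : ∀ B c z .{{_ : NonZero B}} {{_ : NonZero (p * B)}} →
    ((c + B * z) % (p * B) ∸ c % B) / B % p ≡ (c + B * z) / B % p
  top-digit B c z = begin
    (C % (p * B) ∸ c % B) / B % p  ≡⟨ cong (λ x → (x ∸ c % B) / B % p) split ⟩
    (c % B + k * B ∸ c % B) / B % p     ≡⟨ cong (λ x → x / B % p) (m+n∸m≡n (c % B) (k * B)) ⟩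
    k * B / B % p                       ≡⟨ cong (_% p) (m*n/n≡m k B) ⟩
    k % p                               ≡⟨ m%n%n≡m%n (C / B) p ⟩
    C / B % p                           ∎
    where
    open ≡-Reasoning
    C k : ℕ
    C = c + B * z
    k = C / B % p
    split : C % (p * B) ≡ c % B + k * B
    split = begin
      C % (p * B)                               ≡⟨ m≡m%n+[m/n]*n (C % (p * B)) B ⟩
      C % (p * B) % B + C % (p * B) / B * B     ≡⟨ cong₂ (λ x y → x + y * B)
        (trans (m∣n⇒o%n%m≡o%m B (p * B) C (n∣m*n p))
          (trans (cong (λ x → (c + x) % B) (*-comm B z)) ([m+kn]%n≡m%n c z B)))
        (m%[n*o]/o≡m/o%n C p B) ⟩
      c % B + k * B                             ∎

  -- Expresses H through the unreduced quotient C of u^φ(p^r), to which expansions of the power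
  -- apply directly.
  H-value : ∀ u m C → p ∤ u → u ^ (p ^ suc m * (p ∸ 1)) ≡ 1 + p ^ suc (suc m) * C →
    toℕ (H p (suc (suc m)) u) ≡ (C / p ^ suc m) {{m^n≢0 p (suc m)}} % p
  H-value u m C p∤u eq with euler u p∤u m
  ... | c , eq₀ with ^-raise u m c eq₀
  ... | z , eq₁ = begin
      toℕ (H p (suc (suc m)) u)                              ≡⟨ Finₚ.toℕ-fromℕ< _ ⟩
      ((Q p (suc (suc m)) u ∸ Q p (suc m) u) / B) {{B≢0}} % p
        ≡⟨ cong₂ (λ x y → ((x ∸ y) / B) {{B≢0}} % p) (Q-value u (suc m) C p∤u eq) (Q-value u m c p∤u eq₀) ⟩
      (((C % (p * B)) {{pB≢0}} ∸ (c % B) {{B≢0}}) / B) {{B≢0}} % p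
        ≡⟨ cong (λ x → (((x % (p * B)) {{pB≢0}} ∸ (c % B) {{B≢0}}) / B) {{B≢0}} % p) C≡ ⟩
      ((((c + B * z) % (p * B)) {{pB≢0}} ∸ (c % B) {{B≢0}}) / B) {{B≢0}} % p
        ≡⟨ top-digit B c z {{B≢0}} {{pB≢0}} ⟩
      ((c + B * z) / B) {{B≢0}} % p                          ≡⟨ cong (λ x → (x / B) {{B≢0}} % p) C≡ ⟨
      (C / B) {{B≢0}} % p                                    ∎
    where
    open ≡-Reasoning
    B : ℕ
    B = p ^ suc m
    B≢0 : NonZero B
    B≢0 = m^n≢0 p (suc m)
    pB≢0 : NonZero (p * B)
    pB≢0 = m^n≢0 p (suc (suc m))
    C≡ : C ≡ c + B * z
    C≡ = *-cancelˡ-≡ C _ (p * B) {{pB≢0}} (suc-injective (trans (sym eq) eq₁))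

  -- Put p^r = p B. In (u + d p B)^E with E = B (p - 1), the linear term is p B · B (p - 1) u^(E-1)
  -- d and the remainder a multiple of (p B)². So C grows by W B with W ≡ (p - 1) u^(E-1) d modulo
  -- p, and the top digit moves by W.
  H-injective-mod-p : ∀ m u d → p ∤ u →
    H p (suc (suc m)) (u + d * p ^ suc (suc m)) ≡ H p (suc (suc m)) u → p ∣ d
  H-injective-mod-p m u d p∤u H≡ with euler u p∤u (suc m) | ^-first-order u (d * p ^ suc (suc m)) (pred E)
    where
    E : ℕ
    E = p ^ suc m * (p ∸ 1)
  ... | C , eq | K , first-order = conclude
    where
    open ≡-Reasoning
    B E U W u′ : ℕ
    B = p ^ suc m
    E = p ^ suc m * (p ∸ 1)
    U = u ^ pred E
    W = (p ∸ 1) * U * d + p * (d * d * K)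
    u′ = u + d * (p * B)
    instance
      B≢0 : NonZero B
      B≢0 = m^n≢0 p (suc m)
      E≢0 : NonZero E
      E≢0 = m*n≢0 B (p ∸ 1) {{B≢0}} {{>-nonZero p∸1>0}}
    p∣u+⇒ : p ∣ u′ → p ∣ u
    p∣u+⇒ p∣ = ∣m+n∣m⇒∣n (subst (p ∣_) (+-comm u _) p∣) (∣n⇒∣m*n d (m∣m*n B))
    ring : ∀ p B C k U d K → 1 + p * B * C + B * k * U * (d * (p * B)) + d * (p * B) * (d * (p * B)) * K
      ≡ 1 + p * B * (C + (k * U * d + p * (d * d * K)) * B)
    ring = solve-∀
    eq′ : u′ ^ E ≡ 1 + p * B * (C + W * B)
    eq′ = begin
      u′ ^ E                                                ≡⟨ cong (u′ ^_) (suc-pred E) ⟨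
      u′ ^ suc (pred E)                                     ≡⟨ first-order ⟩
      u ^ suc (pred E) + suc (pred E) * U * (d * (p * B)) + d * (p * B) * (d * (p * B)) * K
        ≡⟨ cong (λ e → u ^ e + e * U * (d * (p * B)) + d * (p * B) * (d * (p * B)) * K) (suc-pred E) ⟩
      u ^ E + E * U * (d * (p * B)) + d * (p * B) * (d * (p * B)) * K
        ≡⟨ cong (λ x → x + E * U * (d * (p * B)) + d * (p * B) * (d * (p * B)) * K) eq ⟩
      1 + p * B * C + E * U * (d * (p * B)) + d * (p * B) * (d * (p * B)) * K
        ≡⟨ ring p B C (p ∸ 1) U d K ⟩
      1 + p * B * (C + W * B) ∎
    digits : (C / B) % p ≡ (C / B + W) % p
    digits = begin
      C / B % p               ≡⟨ H-value u m C p∤u eq ⟨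
      toℕ (H p (2 + m) u)     ≡⟨ cong toℕ H≡ ⟨
      toℕ (H p (2 + m) u′)    ≡⟨ H-value u′ m (C + W * B) (p∤u ∘ p∣u+⇒) eq′ ⟩
      (C + W * B) / B % p     ≡⟨ cong (_% p) ([m+k*n]/n C W B) ⟩
      (C / B + W) % p         ∎
    p∣W : p ∣ W
    p∣W = subst (p ∣_) (m+n∸m≡n (C / B) W) (%-≡⇒∣∸ (C / B) (C / B + W) p digits)
    conclude : p ∣ d
    conclude = [ (λ p∣ → contradiction p∣ (p∤-* p∤p∸1 (p∤-^ (pred E) p∤u))) , (λ p∣d → p∣d) ]′
      (euclidsLemma ((p ∸ 1) * U) d pr
        (∣m+n∣m⇒∣n (subst (p ∣_) (+-comm ((p ∸ 1) * U * d) _) p∣W) (m∣m*n (d * d * K))))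

-- Linear recurrences over 𝔽₂

xor-isCommutativeMonoid : IsCommutativeMonoid _≡_ _xor_ false
xor-isCommutativeMonoid = record
  { isMonoid = record
    { isSemigroup = record
      { isMagma = record { isEquivalence = isEquivalence ; ∙-cong = cong₂ _xor_ }
      ; assoc   = xor-assoc
      }
    ; identity = xor-identity
    }
  ; comm = xor-comm
  }

module Σ₂ = Summation _xor_ false xor-isCommutativeMonoid

∧-sum : ∀ n b (f : ℕ → Bool) → b ∧ Σ₂.sum n f ≡ Σ₂.sum n (λ i → b ∧ f i)
∧-sum zero    b f = ∧-zeroʳ b
∧-sum (suc n) b f = trans (∧-distribˡ-xor b (f n) _) (cong ((b ∧ f n) xor_) (∧-sum n b f))

isOdd : ℕ → Bool
isOdd zero    = false
isOdd (suc n) = not (isOdd n)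

isOdd-+ : ∀ m n → isOdd (m + n) ≡ isOdd m xor isOdd n
isOdd-+ zero    n = refl
isOdd-+ (suc m) n = trans (cong not (isOdd-+ m n)) (not-xor (isOdd m) (isOdd n))
  where
  not-xor : ∀ x y → not (x xor y) ≡ not x xor y
  not-xor true  y = not-involutive y
  not-xor false y = refl

isOdd-*2 : ∀ k → isOdd (k * 2) ≡ false
isOdd-*2 zero    = refl
isOdd-*2 (suc k) = trans (not-involutive _) (isOdd-*2 k)

isOdd-% : ∀ n → isOdd n ≡ isOdd (n % 2)
isOdd-% n = trans (cong isOdd (m≡m%n+[m/n]*n n 2)) (trans (isOdd-+ (n % 2) (n / 2 * 2))
  (trans (cong (isOdd (n % 2) xor_) (isOdd-*2 (n / 2))) (xor-identityʳ _)))

sum-isOdd : ∀ n (f : ℕ → Bool) → Σ₂.sum n f ≡ isOdd (Σℕ.sum n ([_] ∘ f))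
sum-isOdd zero    f = refl
sum-isOdd (suc n) f = trans (cong₂ _xor_ (sym (isOdd-[] (f n))) (sum-isOdd n f))
  (sym (isOdd-+ [ f n ] _))
  where
  isOdd-[] : ∀ b → isOdd [ b ] ≡ b
  isOdd-[] true  = refl
  isOdd-[] false = refl

sum₂-const : ∀ n b → Σ₂.sum n (λ _ → b) ≡ isOdd n ∧ b
sum₂-const zero    b = refl
sum₂-const (suc n) b = trans (cong (b xor_) (sum₂-const n b)) (lemma (isOdd n) b)
  where
  lemma : ∀ x b → b xor (x ∧ b) ≡ not x ∧ b
  lemma true  true  = refl
  lemma true  false = refl
  lemma false true  = refl
  lemma false false = refl

-- In characteristic 2 the terms off the diagonal cancel in pairs.
sum-symmetric : ∀ n (f : ℕ → ℕ → Bool) → (∀ i j → f i j ≡ f j i) →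
  Σ₂.sum n (λ i → Σ₂.sum n (f i)) ≡ Σ₂.sum n (λ i → f i i)
sum-symmetric zero    f f-sym = refl
sum-symmetric (suc n) f f-sym = begin
  (f n n xor X) xor Σ₂.sum n (λ i → f i n xor Σ₂.sum n (f i))
    ≡⟨ cong ((f n n xor X) xor_) (Σ₂.sum-∙ n (λ i → f i n) _) ⟩
  (f n n xor X) xor (Σ₂.sum n (λ i → f i n) xor S)
    ≡⟨ cong (λ x → (f n n xor X) xor (x xor S)) (Σ₂.sum-cong n λ i → f-sym i n) ⟩
  (f n n xor X) xor (X xor S)
    ≡⟨ cancel (f n n) X S ⟩
  f n n xor S
    ≡⟨ cong (f n n xor_) (sum-symmetric n f f-sym) ⟩
  f n n xor Σ₂.sum n (λ i → f i i) ∎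
  where
  open ≡-Reasoning
  X S : Bool
  X = Σ₂.sum n (f n)
  S = Σ₂.sum n (λ i → Σ₂.sum n (f i))
  cancel : ∀ d x s → (d xor x) xor (x xor s) ≡ d xor s
  cancel d x s = trans (xor-assoc d x (x xor s)) (cong (d xor_)
    (trans (sym (xor-assoc x x s)) (cong (_xor s) (xor-same x))))

-- The polynomial Σ_{i<n} c i · Xⁱ kills s when X acts as the shift by a.
Annihilates : ℕ → ℕ → (ℕ → Bool) → (ℕ → Bool) → Set
Annihilates a n c s = ∀ u → Σ₂.sum n (λ i → c i ∧ s (u + a * i)) ≡ false

-- C(X)² = C(X²) over 𝔽₂.
frobenius : ∀ a n c s → Annihilates a n c s → Annihilates (2 * a) n c s
frobenius a n c s ann u = begin
  Σ₂.sum n (λ i → c i ∧ s (u + 2 * a * i))        ≡⟨ Σ₂.sum-cong n diagonal ⟨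
  Σ₂.sum n (λ i → f i i)                          ≡⟨ sum-symmetric n f f-sym ⟨
  Σ₂.sum n (λ i → Σ₂.sum n (f i))                 ≡⟨ Σ₂.sum-ε n (λ i _ →
    trans (sym (∧-sum n (c i) _)) (trans (cong (c i ∧_) (ann (u + a * i))) (∧-zeroʳ (c i)))) ⟩
  false                                           ∎
  where
  open ≡-Reasoning
  f : ℕ → ℕ → Bool
  f i j = c i ∧ (c j ∧ s (u + a * i + a * j))
  ring : ∀ u a i → u + a * i + a * i ≡ u + 2 * a * i
  ring = solve-∀
  ring′ : ∀ u a i j → u + a * i + a * j ≡ u + a * j + a * i
  ring′ = solve-∀
  diagonal : ∀ i → f i i ≡ c i ∧ s (u + 2 * a * i)
  diagonal i = trans (sym (∧-assoc (c i) (c i) _))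
    (cong₂ _∧_ (∧-idem (c i)) (cong s (ring u a i)))
  f-sym : ∀ i j → f i j ≡ f j i
  f-sym i j = trans (sym (∧-assoc (c i) (c j) _))
    (trans (cong₂ _∧_ (∧-comm (c i) (c j)) (cong s (ring′ u a i j))) (∧-assoc (c j) (c i) _))

frobenius-^ : ∀ n c s j → Annihilates 1 n c s → Annihilates (2 ^ j) n c s
frobenius-^ n c s zero    ann = ann
frobenius-^ n c s (suc j) ann = frobenius (2 ^ j) n c s (frobenius-^ n c s j ann)

periodic-* : ∀ {N s} → Periodic N s → ∀ k u → s (u + k * N) ≡ s u
periodic-* {N} {s} per zero    u = cong s (+-identityʳ u)
periodic-* {N} {s} per (suc k) u = trans (cong s (ring u N (k * N)))
  (trans (per (u + k * N)) (periodic-* per k u))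
  where
  ring : ∀ u N x → u + (N + x) ≡ u + x + N
  ring = solve-∀

periodic-% : ∀ {N s} .{{_ : NonZero N}} → Periodic N s → ∀ u → s (u % N) ≡ s u
periodic-% {N} {s} per u =
  trans (sym (periodic-* per (u / N) (u % N))) (cong s (sym (m≡m%n+[m/n]*n u N)))

annihilates-% : ∀ N a b n c s .{{_ : NonZero N}} → Periodic N s → a % N ≡ b % N →
  Annihilates a n c s → Annihilates b n c s
annihilates-% N a b n c s per a≡b ann u =
  trans (Σ₂.sum-cong n λ i → cong (c i ∧_) (trans (reduce b i)
    (trans (cong (λ x → s (u + x * i)) (sym a≡b)) (sym (reduce a i))))) (ann u)
  where
  ring : ∀ u x y N i → u + (x + y * N) * i ≡ u + x * i + y * i * N
  ring = solve-∀
  reduce : ∀ a i → s (u + a * i) ≡ s (u + a % N * i)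
  reduce a i = trans (cong (λ x → s (u + x * i)) (m≡m%n+[m/n]*n a N))
    (trans (cong s (ring u (a % N) (a / N) N i)) (periodic-* per (a / N * i) _))

-- Multiplication by X^k. With k = p - b it carries the exponents congruent to b modulo p to
-- multiples of p.
annihilates-shift : ∀ a n c s k → Annihilates a n c s →
  ∀ u → Σ₂.sum n (λ i → c i ∧ s (u + a * (i + k))) ≡ false
annihilates-shift a n c s k ann u =
  trans (Σ₂.sum-cong n λ i → cong (λ x → c i ∧ s x) (ring u a i k)) (ann (u + a * k))
  where
  ring : ∀ u a i k → u + a * (i + k) ≡ u + a * k + a * i
  ring = solve-∀

[1+b]^-mod-b² : ∀ b n → ∃ λ K → (1 + b) ^ n ≡ 1 + n * b + b * b * K
[1+b]^-mod-b² b n with [1+b]^-second-order b n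
... | K , eq = triangle n + b * K , trans eq (ring b (n * b) (triangle n) K)
  where
  ring : ∀ b x t K → 1 + x + t * (b * b) + b * b * b * K ≡ 1 + x + b * b * (t + b * K)
  ring = solve-∀

-- Rigidity of annihilating polynomials

module Rigidity (p : ℕ) .{{_ : NonZero p}} (pr : Prime p) (p-odd : p % 2 ≡ 1)
  (primitive-root : IsPrimitiveRoot 2 (p ^ 2)) where

  open PrimitiveRoot p pr p-odd primitive-root public

  sum-residues : ∀ F K → Periodic p F → p ∤ K → Σ₂.sum p (λ j → F (K * j)) ≡ Σ₂.sum p F
  sum-residues F K per p∤K = trans (Σ₂.sum-cong p λ j → sym (periodic-% per (K * j)))
    (Σ₂.sum-reindex p (λ j → K * j % p) F (λ j _ → m%n<n (K * j) p) injective)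
    where
    below : ∀ i j → j < p → K * i % p ≡ K * j % p → j ≤ i
    below i j j<p eq with euclidsLemma K (j ∸ i) pr
      (subst (p ∣_) (sym (*-distribˡ-∸ K j i)) (%-≡⇒∣∸ (K * i) (K * j) p eq))
    ... | inj₁ p∣K = contradiction p∣K p∤K
    ... | inj₂ p∣j∸i with j ∸ i in j∸i≡
    ...   | zero  = m∸n≡0⇒m≤n j∸i≡
    ...   | suc d = contradiction (∣⇒≤ p∣j∸i)
      (<⇒≱ (subst (_< p) j∸i≡ (≤-<-trans (m∸n≤m j i) j<p)))
    injective : InjectiveBelow p (λ j → K * j % p)
    injective i j i<p j<p eq = ≤-antisym (below j i i<p (sym eq)) (below i j j<p eq)

  -- The counterpart of orthogonality for p-th roots of unity. For p ∤ K the progression runs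
  -- through all the shifts by multiples of q and Φ kills the sum; for p ∣ K all p terms equal
  -- `s w`, and p is odd.
  sum-progression : ∀ q s → Periodic (p * q) s → (∀ u → Σ₂.sum p (λ j → s (u + j * q)) ≡ false) →
    ∀ w K → Σ₂.sum p (λ j → s (w + q * (K * j))) ≡ not (unit K) ∧ s w
  sum-progression q s per Φ w K with p ∣? K
  ... | no p∤K = trans (sum-residues (λ x → s (w + q * x)) K F-periodic p∤K)
      (trans (Σ₂.sum-cong p λ j → cong (λ x → s (w + x)) (*-comm q j)) (Φ w))
    where
    ring : ∀ w q x p → w + q * (x + p) ≡ w + q * x + p * q
    ring = solve-∀
    F-periodic : Periodic p (λ x → s (w + q * x))
    F-periodic x = trans (cong s (ring w q x p)) (per _)
  ... | yes (divides k K≡) = trans (Σ₂.sum-cong p λ j →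
        trans (cong s (trans (cong (λ x → w + q * (x * j)) K≡) (ring w q k p j)))
          (periodic-* per (k * j) w))
      (trans (sum₂-const p (s w)) (cong (_∧ s w) (trans (isOdd-% p) (cong isOdd p-odd))))
    where
    ring : ∀ w q k p j → w + q * (k * p * j) ≡ w + k * j * (p * q)
    ring = solve-∀

  ∣-residue-unique : ∀ i b → i < p → b < p → p ∣ i + (p ∸ b) → i ≡ b
  ∣-residue-unique i b i<p b<p p∣ with <-cmp i b
  ... | tri< i<b _ _ = contradiction p∣ (>⇒∤ {{>-nonZero (≤-trans (m<n⇒0<n∸m b<p) (m≤n+m _ i))}}
    (subst (i + (p ∸ b) <_) (m+[n∸m]≡n (<⇒≤ b<p)) (+-monoˡ-< (p ∸ b) i<b)))
  ... | tri≈ _ i≡b _ = i≡b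
  ... | tri> _ _ b<i = contradiction p∣i∸b
      (>⇒∤ {{>-nonZero (m<n⇒0<n∸m b<i)}} (≤-<-trans (m∸n≤m i b) i<p))
    where
    open ≡-Reasoning
    eq : i + (p ∸ b) ≡ p + (i ∸ b)
    eq = begin
      i + (p ∸ b)            ≡⟨ cong (_+ (p ∸ b)) (m∸n+n≡m (<⇒≤ b<i)) ⟨
      (i ∸ b) + b + (p ∸ b)  ≡⟨ +-assoc (i ∸ b) b (p ∸ b) ⟩
      (i ∸ b) + (b + (p ∸ b)) ≡⟨ cong ((i ∸ b) +_) (m+[n∸m]≡n (<⇒≤ b<p)) ⟩
      (i ∸ b) + p            ≡⟨ +-comm (i ∸ b) p ⟩
      p + (i ∸ b)            ∎
    p∣i∸b : p ∣ i ∸ b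
    p∣i∸b = ∣m+n∣m⇒∣n (subst (p ∣_) eq p∣) ∣-refl

  non-unit-∸-off : ∀ i b → i < p → b < p → i ≢ b → not (unit (i + (p ∸ b))) ≡ false
  non-unit-∸-off i b i<p b<p i≢b =
    cong not (unit-true (i≢b ∘ ∣-residue-unique i b i<p b<p))

  non-unit-∸-on : ∀ b → b < p → not (unit (b + (p ∸ b))) ≡ true
  non-unit-∸-on b b<p =
    cong not (unit-false (subst (p ∣_) (sym (m+[n∸m]≡n (<⇒≤ b<p))) ∣-refl))

  -- The double sum of c i ∧ s (u + a (i + p - b)) over a, i < p is taken both ways. Summing over a
  -- first leaves only i = b. Summing over i first gives 0 unless a = 0, as every other a is a power
  -- of 2 modulo p; the row a = 0 is the sum of all coefficients.
  rigid-mod-p : ∀ s c → Periodic p s → (∀ u → Σ₂.sum p (λ j → s (u + j * 1)) ≡ false) →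
    Annihilates 1 p c s → ∀ u → s u ≡ true → ∀ b → b < p → c b ≡ Σ₂.sum p c
  rigid-mod-p s c per Φ ann u su b b<p = begin
    c b                                             ≡⟨ ∧-identityʳ (c b) ⟨
    c b ∧ true                                      ≡⟨ cong (c b ∧_) (cong₂ _∧_ (non-unit-∸-on b b<p) su) ⟨
    c b ∧ (not (unit (k b)) ∧ s u)                  ≡⟨ Σ₂.sum-single p b _ b<p (λ i i<p i≢b →
      trans (cong (λ x → c i ∧ (x ∧ s u)) (non-unit-∸-off i b i<p b<p i≢b)) (∧-zeroʳ (c i))) ⟨
    Σ₂.sum p (λ i → c i ∧ (not (unit (k i)) ∧ s u)) ≡⟨ Σ₂.sum-cong p column ⟨
    Σ₂.sum p (λ i → Σ₂.sum p (λ a → c i ∧ s (u + a * k i))) ≡⟨ Σ₂.sum-swap p p _ ⟩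
    Σ₂.sum p (λ a → Σ₂.sum p (λ i → c i ∧ s (u + a * k i))) ≡⟨ Σ₂.sum-single p 0 _ (>-nonZero⁻¹ p) row ⟩
    Σ₂.sum p (λ i → c i ∧ s (u + 0))                ≡⟨ Σ₂.sum-cong p (λ i → trans
      (cong (λ x → c i ∧ x) (trans (cong s (+-identityʳ u)) su)) (∧-identityʳ (c i))) ⟩
    Σ₂.sum p c                                      ∎
    where
    open ≡-Reasoning
    k : ℕ → ℕ
    k i = i + (p ∸ b)
    per₁ : Periodic (p * 1) s
    per₁ = subst (λ N → Periodic N s) (sym (*-identityʳ p)) per
    ring : ∀ u a k → u + a * k ≡ u + 1 * (k * a)
    ring = solve-∀
    column : ∀ i → Σ₂.sum p (λ a → c i ∧ s (u + a * k i)) ≡ c i ∧ (not (unit (k i)) ∧ s u)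
    column i = trans (sym (∧-sum p (c i) _)) (cong (c i ∧_)
      (trans (Σ₂.sum-cong p λ a → cong s (ring u a (k i))) (sum-progression 1 s per₁ Φ u (k i))))
    row : ∀ a → a < p → a ≢ 0 → Σ₂.sum p (λ i → c i ∧ s (u + a * k i)) ≡ false
    row a a<p a≢0 with units-are-powers-of-2 a (>⇒∤ {{≢-nonZero a≢0}} a<p)
    ... | j , eq = annihilates-shift a p c s (p ∸ b)
      (annihilates-% p (2 ^ j) a p c s per eq (frobenius-^ p c s j ann)) u

  module Descent (m : ℕ) (s c : ℕ → Bool) (per : Periodic (p ^ suc (suc m)) s)
    (Φ : ∀ u → Σ₂.sum p (λ j → s (u + j * p ^ suc m)) ≡ false)
    (ann : Annihilates 1 (p ^ suc (suc m)) c s) where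

    q N : ℕ
    q = p ^ suc m
    N = p ^ suc (suc m)

    -- Defined by 2^φ(q) = 1 + q γ with p ∤ γ, so that 1 + q γ generates the kernel of reduction
    -- modulo q.
    γ : ℕ
    γ = proj₁ (2^φ-exact m)

    -- N divides q², hence (1 + q γ)^j ≡ 1 + j q γ modulo N, and the left side is a power of 2.
    ann-1+jqγ : ∀ j → Annihilates (1 + j * (q * γ)) N c s
    ann-1+jqγ j with [1+b]^-mod-b² (q * γ) j
    ... | K , eq = annihilates-% N (2 ^ (E * j)) (1 + j * (q * γ)) N c s {{m^n≢0 p (suc (suc m))}} per
        (trans (cong (λ x → (x % N) {{N≢0}}) power)
          ([m+kn]%n≡m%n (1 + j * (q * γ)) (p ^ m * γ * γ * K) N {{N≢0}}))
        (frobenius-^ N c s (E * j) ann)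
      where
      E : ℕ
      E = p ^ m * (p ∸ 1)
      N≢0 : NonZero N
      N≢0 = m^n≢0 p (suc (suc m))
      ring : ∀ x p P γ K → 1 + x + p * P * γ * (p * P * γ) * K ≡ 1 + x + P * γ * γ * K * (p * (p * P))
      ring = solve-∀
      power : 2 ^ (E * j) ≡ 1 + j * (q * γ) + p ^ m * γ * γ * K * N
      power = trans (sym (^-*-assoc 2 E j)) (trans (cong (_^ j) (proj₂ (proj₂ (2^φ-exact m))))
        (trans eq (ring (j * (q * γ)) p (p ^ m) γ K)))

    unit-γ* : ∀ k → unit (γ * k) ≡ unit k
    unit-γ* k with p ∣? k
    ... | yes p∣k = unit-false (∣n⇒∣m*n γ p∣k)
    ... | no p∤k  = unit-true (p∤-* (proj₁ (proj₂ (2^φ-exact m))) p∤k)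

    -- Summing over the multipliers 1 + j q γ (j < p) leaves only the exponents i ≡ b (mod p).
    residue-class : ∀ b u → Σ₂.sum N (λ i → c i ∧ (not (unit (i + (p ∸ b))) ∧ s (u + (i + (p ∸ b))))) ≡ false
    residue-class b u = begin
      Σ₂.sum N (λ i → c i ∧ (not (unit (k i)) ∧ s (u + k i)))     ≡⟨ Σ₂.sum-cong N column ⟨
      Σ₂.sum N (λ i → Σ₂.sum p (λ j → c i ∧ s (u + (1 + j * (q * γ)) * k i))) ≡⟨ Σ₂.sum-swap N p _ ⟩
      Σ₂.sum p (λ j → Σ₂.sum N (λ i → c i ∧ s (u + (1 + j * (q * γ)) * k i))) ≡⟨ Σ₂.sum-ε p (λ j _ →
        annihilates-shift (1 + j * (q * γ)) N c s (p ∸ b) (ann-1+jqγ j) u) ⟩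
      false                                                       ∎
      where
      open ≡-Reasoning
      k : ℕ → ℕ
      k i = i + (p ∸ b)
      ring : ∀ u j q γ k → u + (1 + j * (q * γ)) * k ≡ u + k + q * (γ * k * j)
      ring = solve-∀
      column : ∀ i → Σ₂.sum p (λ j → c i ∧ s (u + (1 + j * (q * γ)) * k i)) ≡
        c i ∧ (not (unit (k i)) ∧ s (u + k i))
      column i = trans (sym (∧-sum p (c i) _)) (cong (c i ∧_)
        (trans (Σ₂.sum-cong p λ j → cong s (ring u j q γ (k i)))
          (trans (sum-progression q s per Φ (u + k i) (γ * k i))
            (cong (λ x → not x ∧ s (u + k i)) (unit-γ* (k i))))))

    -- Each block of p exponents keeps one, b + i p, and the shift by p - b turns it into p + p i.
    -- What remains is a polynomial in X^p.
    ann-section : ∀ b → b < p → ∀ u → Σ₂.sum q (λ i → c (b + i * p) ∧ s (u + p + p * i)) ≡ false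
    ann-section b b<p u = begin
      Σ₂.sum q (λ i → c (b + i * p) ∧ s (u + p + p * i))          ≡⟨ Σ₂.sum-cong q block ⟨
      Σ₂.sum q (λ i → Σ₂.sum p (λ b′ → g (b′ + i * p)))           ≡⟨ Σ₂.sum-* q p g ⟨
      Σ₂.sum (q * p) g                                            ≡⟨ cong (λ n → Σ₂.sum n g) (*-comm q p) ⟩
      Σ₂.sum N g                                                  ≡⟨ residue-class b u ⟩
      false                                                       ∎
      where
      open ≡-Reasoning
      g : ℕ → Bool
      g i = c i ∧ (not (unit (i + (p ∸ b))) ∧ s (u + (i + (p ∸ b))))
      move : ∀ b x y → b + x + y ≡ b + y + x
      move = solve-∀
      unit-block : ∀ b′ i → unit (b′ + i * p + (p ∸ b)) ≡ unit (b′ + (p ∸ b))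
      unit-block b′ i = trans (cong unit (move b′ (i * p) (p ∸ b))) (unit-+* (b′ + (p ∸ b)) i)
      ring : ∀ u p i → u + (p + i * p) ≡ u + p + p * i
      ring = solve-∀
      index : ∀ i → u + (b + i * p + (p ∸ b)) ≡ u + p + p * i
      index i = trans (cong (u +_) (trans (move b (i * p) (p ∸ b))
        (cong (_+ i * p) (m+[n∸m]≡n (<⇒≤ b<p))))) (ring u p i)
      block : ∀ i → Σ₂.sum p (λ b′ → g (b′ + i * p)) ≡ c (b + i * p) ∧ s (u + p + p * i)
      block i = trans (Σ₂.sum-single p b _ b<p λ b′ b′<p b′≢b →
          trans (cong (λ x → c (b′ + i * p) ∧ (not x ∧ s (u + (b′ + i * p + (p ∸ b))))) (unit-block b′ i))
            (trans (cong (λ x → c (b′ + i * p) ∧ (x ∧ s (u + (b′ + i * p + (p ∸ b)))))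
              (non-unit-∸-off b′ b b′<p b<p b′≢b)) (∧-zeroʳ (c (b′ + i * p)))))
        (cong (c (b + i * p) ∧_) (cong₂ _∧_
          (trans (cong not (unit-block b i)) (non-unit-∸-on b b<p)) (cong s (index i))))

    -- Decimation of s by p; the offset p is left over from the shift by p - b.
    section : ℕ → ℕ → Bool
    section u w = s (u + p + p * w)

    section-periodic : ∀ u → Periodic q (section u)
    section-periodic u w = trans (cong s (ring u p w q)) (per (u + p + p * w))
      where
      ring : ∀ u p w q → u + p + p * (w + q) ≡ u + p + p * w + p * q
      ring = solve-∀

    section-Φ : ∀ u w → Σ₂.sum p (λ j → section u (w + j * p ^ m)) ≡ false
    section-Φ u w = trans (Σ₂.sum-cong p λ j → cong s (ring u p w j (p ^ m))) (Φ (u + p + p * w))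
      where
      ring : ∀ u p w j P → u + p + p * (w + j * P) ≡ u + p + p * w + j * (p * P)
      ring = solve-∀

    section-ann : ∀ u b → b < p → Annihilates 1 q (λ i → c (b + i * p)) (section u)
    section-ann u b b<p w = trans
      (Σ₂.sum-cong q λ i → cong (λ x → c (b + i * p) ∧ s x) (ring u p w i))
      (ann-section b b<p (u + p * w))
      where
      ring : ∀ u p w i → u + p + p * (w + 1 * i) ≡ u + p * w + p + p * i
      ring = solve-∀

    -- Hands a nonzero value of s on to the decimation: at q - 1 the offset completes a full period
    -- N.
    section-last : ∀ u → section u (q ∸ 1) ≡ s u
    section-last u = trans (cong s (trans (ring u p (q ∸ 1))
      (cong (λ x → u + p * x) (m+[n∸m]≡n (m^n>0 p (suc m)))))) (per u)
      where
      ring : ∀ u p x → u + p + p * x ≡ u + p * (1 + x)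
      ring = solve-∀

  -- Descent on the level: each residue section i ↦ c (b + i p) kills a decimation of s, which is
  -- nonzero and satisfies the Φ-relation one level lower. A step by q in c is a step by q / p
  -- inside a section.
  rigid : ∀ m s c → Periodic (p ^ suc m) s → (∀ u → Σ₂.sum p (λ j → s (u + j * p ^ m)) ≡ false) →
    Annihilates 1 (p ^ suc m) c s → ∀ u → s u ≡ true →
    ∀ i → i + p ^ m < p ^ suc m → c (i + p ^ m) ≡ c i
  rigid zero s c per Φ ann u su i i+1<p =
    trans (const (i + 1) i+1<p) (sym (const i (≤-<-trans (m≤m+n i 1) i+1<p)))
    where
    const : ∀ b → b < p ^ 1 → c b ≡ Σ₂.sum p c
    const b b<p = rigid-mod-p s c (subst (λ N → Periodic N s) (*-identityʳ p) per) Φ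
      (subst (λ N → Annihilates 1 N c s) (*-identityʳ p) ann) u su b
      (subst (b <_) (*-identityʳ p) b<p)
  rigid (suc m) s c per Φ ann u su i i+q<N = begin
    c (i + q)                           ≡⟨ cong (λ x → c (x + q)) (m≡m%n+[m/n]*n i p) ⟩
    c (i % p + i / p * p + p * p ^ m)   ≡⟨ cong c (ring (i % p) (i / p) p (p ^ m)) ⟩
    c (i % p + (i / p + p ^ m) * p)     ≡⟨ rigid m (section u) (λ j → c (i % p + j * p))
                                             (section-periodic u) (section-Φ u) (section-ann u (i % p) (m%n<n i p))
                                             (q ∸ 1) (trans (section-last u) su) (i / p) i/p+P<q ⟩
    c (i % p + i / p * p)               ≡⟨ cong c (m≡m%n+[m/n]*n i p) ⟨
    c i                                 ∎
    where
    open ≡-Reasoning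
    open Descent m s c per Φ ann
    ring : ∀ b x p P → b + x * p + p * P ≡ b + (x + P) * p
    ring = solve-∀
    i/p+P<q : i / p + p ^ m < q
    i/p+P<q = subst (_< q) (trans (cong (λ x → (i + x) / p) (*-comm p (p ^ m))) ([m+k*n]/n i (p ^ m) p))
      (m<n*o⇒m/o<n (subst (i + q <_) (*-comm p q) i+q<N))

-- Recurrences as monic annihilators; the difference and fold operators

xor≡false⇒≡ : ∀ x y → x xor y ≡ false → x ≡ y
xor≡false⇒≡ true  true  _ = refl
xor≡false⇒≡ false false _ = refl

-- The characteristic polynomial X^L + Σ cᵢ Xⁱ, extended by zeros; in characteristic 2 no signs
-- appear.
coeff : ∀ L → (Fin L → Bool) → ℕ → Bool
coeff zero    c zero    = true
coeff zero    c (suc i) = false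
coeff (suc L) c zero    = c Fin.zero
coeff (suc L) c (suc i) = coeff L (c ∘ Fin.suc) i

coeff-lead : ∀ L c → coeff L c L ≡ true
coeff-lead zero    c = refl
coeff-lead (suc L) c = coeff-lead L (c ∘ Fin.suc)

coeff-> : ∀ L c i → L < i → coeff L c i ≡ false
coeff-> zero    c (suc i) _ = refl
coeff-> (suc L) c (suc i) L<i = coeff-> L (c ∘ Fin.suc) i (s≤s⁻¹ L<i)

coeff-toℕ : ∀ L (f : ℕ → Bool) i → i < L → coeff L (f ∘ toℕ) i ≡ f i
coeff-toℕ (suc L) f zero    _   = refl
coeff-toℕ (suc L) f (suc i) i<L = coeff-toℕ L (f ∘ suc) i (s≤s⁻¹ i<L)

sum-coeff : ∀ L c s u → Σ₂.sum (suc L) (λ i → coeff L c i ∧ s (u + i)) ≡ recSum L c s u xor s (u + L)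
sum-coeff zero    c s u = xor-identityʳ (s (u + 0))
sum-coeff (suc L) c s u = begin
  Σ₂.sum (2 + L) (λ i → coeff (suc L) c i ∧ s (u + i))
    ≡⟨ Σ₂.sum-first (suc L) (λ i → coeff (suc L) c i ∧ s (u + i)) ⟩
  (c Fin.zero ∧ s (u + 0)) xor Σ₂.sum (suc L) (λ i → coeff L (c ∘ Fin.suc) i ∧ s (u + suc i))
    ≡⟨ cong₂ (λ x y → (c Fin.zero ∧ s x) xor y) (+-identityʳ u) (trans
         (Σ₂.sum-cong (suc L) λ i → cong (λ x → coeff L (c ∘ Fin.suc) i ∧ s x) (+-suc u i))
         (sum-coeff L (c ∘ Fin.suc) s (suc u))) ⟩
  (c Fin.zero ∧ s u) xor (recSum L (c ∘ Fin.suc) s (suc u) xor s (suc u + L))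
    ≡⟨ xor-assoc (c Fin.zero ∧ s u) _ _ ⟨
  recSum (suc L) c s u xor s (suc u + L)
    ≡⟨ cong (λ x → recSum (suc L) c s u xor s x) (+-suc u L) ⟨
  recSum (suc L) c s u xor s (u + suc L) ∎
  where open ≡-Reasoning

-- The zeros above degree l let the same C be read with N coefficients for any N > l, as `rigid`
-- requires, while `lead` retains the degree.
record KilledByMonic (l : ℕ) (s : ℕ → Bool) : Set where
  field
    C       : ℕ → Bool
    lead    : C l ≡ true
    above   : ∀ i → l < i → C i ≡ false
    kills   : ∀ u → Σ₂.sum (suc l) (λ i → C i ∧ s (u + i)) ≡ false

  annihilates : ∀ N → l < N → Annihilates 1 N C s
  annihilates N l<N u = trans (Σ₂.sum-cong N λ i → cong (λ x → C i ∧ s (u + x)) (*-identityˡ i))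
    (trans (Σ₂.sum-extend (suc l) N _ l<N λ i l<i _ → cong (_∧ s (u + i)) (above i l<i)) (kills u))

recurrence⇒killed : ∀ {L s} → HasRecurrence s L → KilledByMonic L s
recurrence⇒killed {L} {s} (c , _ , rec) = record
  { C = coeff L c ; lead = coeff-lead L c ; above = coeff-> L c
  ; kills = λ u → trans (sum-coeff L c s u)
      (trans (cong (recSum L c s u xor_) (rec u)) (xor-same (recSum L c s u))) }

leadOK : ∀ L (f : ℕ → Bool) → f 0 ≡ true → LeadOK L (f ∘ toℕ)
leadOK zero    f f0 = _
leadOK (suc L) f f0 = f0

kills⇒recurrence : ∀ L s (f : ℕ → Bool) → f 0 ≡ true → f L ≡ true →
  (∀ u → Σ₂.sum (suc L) (λ i → f i ∧ s (u + i)) ≡ false) → HasRecurrence s L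
kills⇒recurrence L s f f0 fL kills = f ∘ toℕ , leadOK L f f0 , λ u →
  sym (xor≡false⇒≡ _ _ (trans (sym (sum-coeff L (f ∘ toℕ) s u))
    (trans (Σ₂.sum-cong-< (suc L) λ i i≤L → cong (_∧ s (u + i)) (agree i i≤L)) (kills u))))
  where
  agree : ∀ i → i < suc L → coeff L (f ∘ toℕ) i ≡ f i
  agree i i≤L with i ≟ L
  ... | yes refl = trans (coeff-lead L _) (sym fL)
  ... | no i≢L   = coeff-toℕ L f i (≤∧≢⇒< (s≤s⁻¹ i≤L) i≢L)

-- This is (E^q - 1) t. Because X^N - 1 = (X^q - 1) Φ_N for N = p q, it lies in the kernel of Φ_N(E)
-- when t has period N, and it vanishes exactly when t has period q.
Δ : ℕ → (ℕ → Bool) → ℕ → Bool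
Δ q t u = t (u + q) xor t u

sum-telescope : ∀ n (f : ℕ → Bool) → Σ₂.sum n (λ j → f (suc j) xor f j) ≡ f n xor f 0
sum-telescope zero    f = sym (xor-same (f 0))
sum-telescope (suc n) f = trans (cong ((f (suc n) xor f n) xor_) (sum-telescope n f))
  (cancel (f (suc n)) (f n) (f 0))
  where
  cancel : ∀ x y z → (x xor y) xor (y xor z) ≡ x xor z
  cancel x y z = trans (xor-assoc x y (y xor z)) (cong (x xor_)
    (trans (sym (xor-assoc y y z)) (cong (_xor z) (xor-same y))))

+-swap-last : ∀ u v w → u + v + w ≡ u + w + v
+-swap-last = solve-∀

Δ-periodic : ∀ N q t → Periodic N t → Periodic N (Δ q t)
Δ-periodic N q t per u = cong₂ _xor_ (trans (cong t (+-swap-last u N q)) (per (u + q))) (per u)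

Δ-annihilates : ∀ N q c t → Annihilates 1 N c t → Annihilates 1 N c (Δ q t)
Δ-annihilates N q c t ann u = begin
  Σ₂.sum N (λ i → c i ∧ (t (u + 1 * i + q) xor t (u + 1 * i)))
    ≡⟨ Σ₂.sum-cong N (λ i → trans (∧-distribˡ-xor (c i) _ _)
         (cong (λ x → (c i ∧ t x) xor (c i ∧ t (u + 1 * i))) (+-swap-last u (1 * i) q))) ⟩
  Σ₂.sum N (λ i → (c i ∧ t (u + q + 1 * i)) xor (c i ∧ t (u + 1 * i)))
    ≡⟨ Σ₂.sum-∙ N _ _ ⟩
  Σ₂.sum N (λ i → c i ∧ t (u + q + 1 * i)) xor Σ₂.sum N (λ i → c i ∧ t (u + 1 * i))
    ≡⟨ cong₂ _xor_ (ann (u + q)) (ann u) ⟩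
  false ∎
  where open ≡-Reasoning

Δ-sum : ∀ n q t → Periodic (n * q) t → ∀ u → Σ₂.sum n (λ j → Δ q t (u + j * q)) ≡ false
Δ-sum n q t per u = begin
  Σ₂.sum n (λ j → t (u + j * q + q) xor t (u + j * q))
    ≡⟨ Σ₂.sum-cong n (λ j → cong (λ x → t x xor t (u + j * q)) (ring u j q)) ⟩
  Σ₂.sum n (λ j → t (u + suc j * q) xor t (u + j * q))
    ≡⟨ sum-telescope n (λ j → t (u + j * q)) ⟩
  t (u + n * q) xor t (u + 0)
    ≡⟨ cong₂ _xor_ (per u) (cong t (+-identityʳ u)) ⟩
  t u xor t u
    ≡⟨ xor-same (t u) ⟩
  false ∎
  where
  open ≡-Reasoning
  ring : ∀ u j q → u + j * q + q ≡ u + suc j * q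
  ring = solve-∀

true-or-all-false : ∀ N s .{{_ : NonZero N}} → Periodic N s →
  (∃ λ u → s u ≡ true) ⊎ (∀ u → s u ≡ false)
true-or-all-false N s per with anyUpTo? (λ u → s u Bool.≟ true) N
... | yes (u , _ , su) = inj₁ (u , su)
... | no ¬any = inj₂ λ u → trans (sym (periodic-% per u))
  (¬-not λ eq → ¬any (u % N , m%n<n u N , eq))

-- For n = p and q = pᵐ this is Φ_{pᵐ⁺¹}(E) t, where E is the shift.
fold : ℕ → ℕ → (ℕ → Bool) → ℕ → Bool
fold n q t u = Σ₂.sum n (λ j → t (u + j * q))

fold-periodic : ∀ n q t → Periodic (n * q) t → Periodic q (fold n q t)
fold-periodic n q t per u = xor≡false⇒≡ _ _ (begin
  fold n q t (u + q) xor fold n q t u           ≡⟨ cong (_xor fold n q t u) (Σ₂.sum-cong n λ j →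
                                                     cong t (+-swap-last u q (j * q))) ⟩
  Σ₂.sum n (λ j → t (u + j * q + q)) xor fold n q t u  ≡⟨ Σ₂.sum-∙ n _ _ ⟨
  Σ₂.sum n (λ j → Δ q t (u + j * q))            ≡⟨ Δ-sum n q t per u ⟩
  false                                         ∎)
  where open ≡-Reasoning

sum-fold : ∀ n q t (G : ℕ → Bool) u →
  Σ₂.sum q (λ b → G b ∧ fold n q t (u + b)) ≡
  Σ₂.sum n (λ j → Σ₂.sum q (λ b → G b ∧ t (u + (b + j * q))))
sum-fold n q t G u = trans (Σ₂.sum-cong q λ b → trans (∧-sum n (G b) _)
    (Σ₂.sum-cong n λ j → cong (λ x → G b ∧ t x) (+-assoc u b (j * q))))
  (Σ₂.sum-swap q n _)

[b+j*q]%q≡b : ∀ b j q .{{_ : NonZero q}} → b < q → (b + j * q) % q ≡ b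
[b+j*q]%q≡b b j q b<q = trans ([m+kn]%n≡m%n b j q) (m<n⇒m%n≡m b<q)

-- Bounds on the order of a recurrence for sequences of prime-power period

module Complexity (p : ℕ) .{{_ : NonZero p}} (pr : Prime p) (p-odd : p % 2 ≡ 1)
  (primitive-root : IsPrimitiveRoot 2 (p ^ 2)) where

  open Rigidity p pr p-odd primitive-root public

  [p∸1]*q+q : ∀ q → (p ∸ 1) * q + q ≡ p * q
  [p∸1]*q+q q = trans (+-comm ((p ∸ 1) * q) q) (cong (_* q) (sym p≡1+[p∸1]))

  module AtLevel (m : ℕ) where

    q D N : ℕ
    q = p ^ m
    D = (p ∸ 1) * q
    N = p ^ suc m

    instance
      q≢0 : NonZero q
      q≢0 = m^n≢0 p m

      N≢0 : NonZero N
      N≢0 = m^n≢0 p (suc m)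

    q>0 : 0 < q
    q>0 = >-nonZero⁻¹ q

    D+q≡N : D + q ≡ N
    D+q≡N = [p∸1]*q+q q

    D<N : D < N
    D<N = subst (D <_) D+q≡N (m<m+n D q>0)

    constant-on-classes : ∀ (C : ℕ → Bool) → (∀ i → i + q < N → C (i + q) ≡ C i) →
      ∀ b j → b < q → j < p → C (b + j * q) ≡ C b
    constant-on-classes C step b zero    b<q _   = cong C (+-identityʳ b)
    constant-on-classes C step b (suc j) b<q j<p = trans (cong C (ring b q (j * q)))
      (trans (step (b + j * q) (subst (_< N) (ring b q (j * q))
          (<-≤-trans (+-monoˡ-< (suc j * q) b<q) (*-monoˡ-≤ q j<p))))
        (constant-on-classes C step b j b<q (<⇒≤ j<p)))
      where
      ring : ∀ b q x → b + (q + x) ≡ b + x + q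
      ring = solve-∀

    module NonPeriodic (t : ℕ → Bool) (per : Periodic N t) (u₀ : ℕ) (Δu₀ : Δ q t u₀ ≡ true)
      (L : ℕ) (L<N : L < N) (killed : KilledByMonic L t) where

      open KilledByMonic killed

      constant : ∀ b j → b < q → j < p → C (b + j * q) ≡ C b
      constant = constant-on-classes C (rigid m (Δ q t) C (Δ-periodic N q t per)
        (Δ-sum p q t per) (Δ-annihilates N q C t (annihilates N L<N)) u₀ Δu₀)

      D≤L : D ≤ L
      -- The class of L modulo q has the member L % q + D in the top block; if L < D, it lies beyond
      -- the degree, where C is 0, while C L = 1.
      D≤L = ≮⇒≥ λ L<D → contradiction (begin
        true                        ≡⟨ lead ⟨
        C L                         ≡⟨ cong C (m≡m%n+[m/n]*n L q) ⟩
        C (L % q + L / q * q)       ≡⟨ constant (L % q) (L / q) (m%n<n L q) (m<n*o⇒m/o<n L<N) ⟩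
        C (L % q)                   ≡⟨ constant (L % q) (p ∸ 1) (m%n<n L q) p∸1<p ⟨
        C (L % q + D)               ≡⟨ above _ (<-≤-trans L<D (m≤n+m D (L % q))) ⟩
        false                       ∎) λ ()
        where open ≡-Reasoning

      L∸D+D≡L : L ∸ D + D ≡ L
      L∸D+D≡L = m∸n+n≡m D≤L

      -- All blocks of q coefficients of C agree, so C = Φ_N · G for any block G. The top block is
      -- chosen because it shows G to be monic of degree L - D.
      fold-killed : KilledByMonic (L ∸ D) (fold p q t)
      fold-killed = record
        { C     = λ b → C (b + D)
        ; lead  = trans (cong C L∸D+D≡L) lead
        ; above = λ b L∸D<b → above (b + D) (subst (_< b + D) L∸D+D≡L (+-monoˡ-< D L∸D<b))
        ; kills = λ u → begin
            Σ₂.sum (suc (L ∸ D)) (λ b → C (b + D) ∧ fold p q t (u + b))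
              ≡⟨ Σ₂.sum-extend (suc (L ∸ D)) q _ L∸D<q (λ b L∸D<b _ → cong (_∧ fold p q t (u + b))
                   (above (b + D) (subst (_< b + D) L∸D+D≡L (+-monoˡ-< D L∸D<b)))) ⟨
            Σ₂.sum q (λ b → C (b + D) ∧ fold p q t (u + b))
              ≡⟨ sum-fold p q t _ u ⟩
            Σ₂.sum p (λ j → Σ₂.sum q (λ b → C (b + D) ∧ t (u + (b + j * q))))
              ≡⟨ Σ₂.sum-cong-< p (λ j j<p → Σ₂.sum-cong-< q λ b b<q → cong (_∧ t (u + (b + j * q)))
                   (trans (constant b (p ∸ 1) b<q p∸1<p) (sym (constant b j b<q j<p)))) ⟩
            Σ₂.sum p (λ j → Σ₂.sum q (λ b → C (b + j * q) ∧ t (u + (b + j * q))))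
              ≡⟨ Σ₂.sum-* p q (λ i → C i ∧ t (u + i)) ⟨
            Σ₂.sum N (λ i → C i ∧ t (u + i))
              ≡⟨ Σ₂.sum-cong N (λ i → cong (λ x → C i ∧ t (u + x)) (sym (*-identityˡ i))) ⟩
            Σ₂.sum N (λ i → C i ∧ t (u + 1 * i))
              ≡⟨ annihilates N L<N u ⟩
            false ∎
        }
        where
        open ≡-Reasoning
        L∸D<q : L ∸ D < q
        L∸D<q = +-cancelʳ-< D (L ∸ D) q
          (subst₂ _<_ (sym L∸D+D≡L) (trans (sym D+q≡N) (+-comm D q)) L<N)

    Δ-true-or-periodic : ∀ t → Periodic N t → (∃ λ u → Δ q t u ≡ true) ⊎ Periodic q t
    Δ-true-or-periodic t per with true-or-all-false N (Δ q t) (Δ-periodic N q t per)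
    ... | inj₁ found     = inj₁ found
    ... | inj₂ all-false = inj₂ λ u → xor≡false⇒≡ _ _ (all-false u)

    killed⇒smaller-period : ∀ t l → Periodic N t → KilledByMonic l t → l < D → Periodic q t
    killed⇒smaller-period t l per killed l<D with Δ-true-or-periodic t per
    ... | inj₂ per-q    = per-q
    ... | inj₁ (u , Δu) =
      contradiction (NonPeriodic.D≤L t per u Δu l (<-trans l<D D<N) killed) (<⇒≱ l<D)

  -- At each level D = (p - 1) pᵐ ≥ p - 1 > l, so the period drops by a factor p until it is 1.
  killed⇒constant : ∀ m t l → Periodic (p ^ m) t → KilledByMonic l t → l < p ∸ 1 → Periodic 1 t
  killed⇒constant zero    t l per killed l< = per
  killed⇒constant (suc m) t l per killed l< = killed⇒constant m t l
    (AtLevel.killed⇒smaller-period m t l per killed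
      (<-≤-trans l< (m≤m*n (p ∸ 1) (p ^ m) {{m^n≢0 p m}}))) killed l<

  module Bounds (m : ℕ) where
    open AtLevel m public

    module _ (t : ℕ → Bool) (per : Periodic N t) (u₀ : ℕ) (Δu₀ : Δ q t u₀ ≡ true) where

      complexity≥D : ∀ L → HasRecurrence t L → D ≤ L
      complexity≥D L rec = ≮⇒≥ λ L<D → <⇒≱ L<D
        (NonPeriodic.D≤L t per u₀ Δu₀ L (<-trans L<D D<N) (recurrence⇒killed rec))

      -- Order exactly D would leave a monic polynomial of degree 0, the constant 1, killing the
      -- fold.
      complexity≥D+1 : ∀ v → fold p q t v ≡ true → ∀ L → HasRecurrence t L → D + 1 ≤ L
      complexity≥D+1 v gv L rec = ≮⇒≥ λ L<D+1 → absurd (≤-antisym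
        (s≤s⁻¹ (subst (L <_) (+-comm D 1) L<D+1)) (complexity≥D L rec))
        where
        absurd : L ≢ D
        absurd refl = contradiction (begin
          true                                              ≡⟨ cong₂ _∧_ lead (trans (cong (fold p q t) (+-identityʳ v)) gv) ⟨
          C 0 ∧ fold p q t (v + 0)                          ≡⟨ xor-identityʳ _ ⟨
          Σ₂.sum 1 (λ b → C b ∧ fold p q t (v + b))         ≡⟨ kills v ⟩
          false                                             ∎) λ ()
          where
          open ≡-Reasoning
          open KilledByMonic (subst (λ l → KilledByMonic l (fold p q t)) (n∸n≡0 D)
            (NonPeriodic.fold-killed t per u₀ Δu₀ D D<N (recurrence⇒killed rec)))

      -- A smaller order would leave degree below p - 1 for the fold and make it constant. The bound
      -- by q keeps the order below N, where rigidity applies.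
      complexity≥D+p∸1 : p ∸ 1 ≤ q → ∀ v w → fold p q t v ≡ true → fold p q t w ≡ false →
        ∀ L → HasRecurrence t L → D + (p ∸ 1) ≤ L
      complexity≥D+p∸1 p∸1≤q v w gv gw L rec = ≮⇒≥ λ L< →
        let L<N = <-≤-trans L< (subst (D + (p ∸ 1) ≤_) D+q≡N (+-monoʳ-≤ D p∸1≤q))
            constant = killed⇒constant m (fold p q t) (L ∸ D) (fold-periodic p q t per)
              (NonPeriodic.fold-killed t per u₀ Δu₀ L L<N (recurrence⇒killed rec))
              (+-cancelˡ-< D _ _ (subst (_< D + (p ∸ 1))
                (sym (m+[n∸m]≡n (complexity≥D L rec))) L<))
            at-0 = λ u → trans (cong (fold p q t) (sym (*-identityʳ u))) (periodic-* constant u 0)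
        in contradiction (trans (sym gv) (trans (at-0 v) (trans (sym (at-0 w)) gw))) λ ()

    -- The characteristic polynomial is Φ_N(X) · (1 + X + ⋯ + Xᵇ).
    window-recurrence : ∀ t b → b < q → (∀ u → Σ₂.sum (suc b) (λ i → fold p q t (u + i)) ≡ false) →
      HasRecurrence t (D + b)
    window-recurrence t b b<q window = kills⇒recurrence (D + b) t f f0 fL kills
      where
      open ≡-Reasoning
      f : ℕ → Bool
      -- Since b < q, the shifts of 1 + X + ⋯ + Xᵇ by multiples of q do not overlap.
      f i = does (i % q ≤? b)
      f-class : ∀ b′ j → b′ < q → f (b′ + j * q) ≡ does (b′ ≤? b)
      f-class b′ j b′<q = cong (λ x → does (x ≤? b)) ([b+j*q]%q≡b b′ j q b′<q)
      f0 : f 0 ≡ true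
      f0 = trans (f-class 0 0 q>0) refl
      fL : f (D + b) ≡ true
      fL = trans (cong f (+-comm D b)) (trans (f-class b (p ∸ 1) b<q) (dec-true (b ≤? b) ≤-refl))
      beyond : ∀ i → suc (D + b) ≤ i → i < N → f i ≡ false
      beyond i D+b<i i<N = begin
        f i                           ≡⟨ cong f (m∸n+n≡m D≤i) ⟨
        f (i ∸ D + D)                 ≡⟨ f-class (i ∸ D) (p ∸ 1) (+-cancelʳ-< D (i ∸ D) q
                                           (subst₂ _<_ (sym (m∸n+n≡m D≤i)) (trans (sym D+q≡N) (+-comm D q)) i<N)) ⟩
        does (i ∸ D ≤? b)             ≡⟨ dec-false (i ∸ D ≤? b) (<⇒≱ (+-cancelˡ-< D b (i ∸ D)
                                           (subst (D + b <_) (sym (m+[n∸m]≡n D≤i)) D+b<i))) ⟩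
        false                         ∎
        where
        D≤i : D ≤ i
        D≤i = ≤-trans (m≤m+n D b) (<⇒≤ D+b<i)
      kills : ∀ u → Σ₂.sum (suc (D + b)) (λ i → f i ∧ t (u + i)) ≡ false
      kills u = begin
        Σ₂.sum (suc (D + b)) (λ i → f i ∧ t (u + i))
          ≡⟨ Σ₂.sum-extend (suc (D + b)) N _ (subst (D + b <_) D+q≡N (+-monoʳ-< D b<q))
               (λ i lo hi → cong (_∧ t (u + i)) (beyond i lo hi)) ⟨
        Σ₂.sum N (λ i → f i ∧ t (u + i))
          ≡⟨ Σ₂.sum-* p q _ ⟩
        Σ₂.sum p (λ j → Σ₂.sum q (λ b′ → f (b′ + j * q) ∧ t (u + (b′ + j * q))))
          ≡⟨ Σ₂.sum-cong p (λ j → Σ₂.sum-cong-< q λ b′ b′<q →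
               cong (_∧ t (u + (b′ + j * q))) (f-class b′ j b′<q)) ⟩
        Σ₂.sum p (λ j → Σ₂.sum q (λ b′ → does (b′ ≤? b) ∧ t (u + (b′ + j * q))))
          ≡⟨ sum-fold p q t _ u ⟨
        Σ₂.sum q (λ b′ → does (b′ ≤? b) ∧ fold p q t (u + b′))
          ≡⟨ Σ₂.sum-extend (suc b) q _ b<q (λ b′ b<b′ _ → cong (_∧ fold p q t (u + b′))
               (dec-false (b′ ≤? b) (<⇒≱ b<b′))) ⟩
        Σ₂.sum (suc b) (λ b′ → does (b′ ≤? b) ∧ fold p q t (u + b′))
          ≡⟨ Σ₂.sum-cong-< (suc b) (λ b′ b′≤b → cong (_∧ fold p q t (u + b′))
               (dec-true (b′ ≤? b) (s≤s⁻¹ b′≤b))) ⟩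
        Σ₂.sum (suc b) (λ b′ → fold p q t (u + b′))
          ≡⟨ window u ⟩
        false ∎

-- Hamming distances and the sequence f

member : ∀ {n} → Subset n → ℕ → Bool
member []      _       = false
member (b ∷ I) zero    = b
member (b ∷ I) (suc l) = member I l

member-∈? : ∀ {n} (x : Fin n) (I : Subset n) → does (x ∈? I) ≡ member I (toℕ x)
member-∈? Fin.zero    (true  ∷ I) = refl
member-∈? Fin.zero    (false ∷ I) = refl
member-∈? (Fin.suc x) (b ∷ I)     = member-∈? x I

sum-member : ∀ {n} (I : Subset n) → Σℕ.sum n ([_] ∘ member I) ≡ ∣ I ∣
sum-member         []          = refl
sum-member {suc n} (true  ∷ I) = trans (Σℕ.sum-first n ([_] ∘ member (true ∷ I))) (cong suc (sum-member I))
sum-member {suc n} (false ∷ I) = trans (Σℕ.sum-first n ([_] ∘ member (false ∷ I))) (sum-member I)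

hamming-sum : ∀ n s t → hamming n s t ≡ Σℕ.sum n (λ i → [ s i xor t i ])
hamming-sum zero    s t = refl
hamming-sum (suc n) s t = cong ([ s n xor t n ] +_) (hamming-sum n s t)

hamming-classes : ∀ n q s t →
  hamming (n * q) s t ≡ Σℕ.sum q (λ b → Σℕ.sum n (λ j → [ s (b + j * q) xor t (b + j * q) ]))
hamming-classes n q s t = trans (hamming-sum (n * q) s t)
  (trans (Σℕ.sum-* n q _) (Σℕ.sum-swap n q _))

[isOdd]≤ : ∀ n → [ isOdd n ] ≤ n
[isOdd]≤ zero = z≤n
[isOdd]≤ (suc n) with isOdd n
... | true  = z≤n
... | false = s≤s z≤n

-- Folds that differ at b differ by an odd number of terms of the class of b, hence by at least one.
hamming-fold : ∀ n q s t →
  Σℕ.sum q (λ b → [ fold n q s b xor fold n q t b ]) ≤ hamming (n * q) s t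
hamming-fold n q s t = subst (Σℕ.sum q (λ b → [ fold n q s b xor fold n q t b ]) ≤_)
  (sym (hamming-classes n q s t)) (sum-mono-≤ q λ b _ →
    subst (λ x → [ x ] ≤ Σℕ.sum n (λ j → [ s (b + j * q) xor t (b + j * q) ])) (sym (trans (sym (Σ₂.sum-∙ n _ _)) (sum-isOdd n _))) ([isOdd]≤ _))

sum-*ʳ : ∀ n (f : ℕ → ℕ) c → Σℕ.sum n (λ i → f i * c) ≡ Σℕ.sum n f * c
sum-*ʳ zero    f c = refl
sum-*ʳ (suc n) f c = trans (cong (f n * c +_) (sum-*ʳ n f c)) (sym (*-distribʳ-+ c (f n) _))

sum-complement : ∀ n (f : ℕ → Bool) → Σℕ.sum n (λ i → [ f i ]) + Σℕ.sum n (λ i → [ not (f i) ]) ≡ n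
sum-complement n f = trans (sym (Σℕ.sum-∙ n _ _)) (trans (Σℕ.sum-cong n λ i → one (f i))
  (trans (sum-const n 1) (*-identityʳ n)))
  where
  one : ∀ b → [ b ] + [ not b ] ≡ 1
  one true  = refl
  one false = refl

sum-window : ∀ n (F : ℕ → Bool) → Periodic n F → ∀ u → Σ₂.sum n (λ i → F (u + i)) ≡ Σ₂.sum n F
sum-window n F per zero    = refl
sum-window n F per (suc u) = trans (xor-cancelˡ (F u) _ _ (begin
    F u xor Σ₂.sum n (λ i → F (suc u + i))
      ≡⟨ cong₂ _xor_ (cong F (sym (+-identityʳ u))) (Σ₂.sum-cong n λ i → cong F (sym (+-suc u i))) ⟩
    F (u + 0) xor Σ₂.sum n (λ i → F (u + suc i))
      ≡⟨ Σ₂.sum-first n (λ i → F (u + i)) ⟨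
    F (u + n) xor Σ₂.sum n (λ i → F (u + i))
      ≡⟨ cong (_xor Σ₂.sum n (λ i → F (u + i))) (per u) ⟩
    F u xor Σ₂.sum n (λ i → F (u + i)) ∎)) (sum-window n F per u)
  where
  open ≡-Reasoning
  xor-cancelˡ : ∀ x y z → x xor y ≡ x xor z → y ≡ z
  xor-cancelˡ false y z eq = eq
  xor-cancelˡ true  y z eq = trans (sym (not-involutive y)) (trans (cong not eq) (not-involutive z))

-- One lower bound for all recurrences of all close sequences serves twice: it makes L the
-- complexity of t, and it makes t optimal.
kErrorLC : ∀ {T k s L} t → Periodic T t → hamming T s t ≤ k → HasRecurrence t L →
  (∀ t L′ → Periodic T t → hamming T s t ≤ k → HasRecurrence t L′ → L ≤ L′) → IsKErrorLC T k s L
kErrorLC t per close rec minimal =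
  (t , per , close , rec , λ L′ → minimal t L′ per close) ,
  λ t′ L′ per′ close′ lc → minimal t′ L′ per′ close′ (proj₁ lc)

-- The top-digit sequence and the cost of modifying it

module TopDigitSequence (p : ℕ) .{{_ : NonZero p}} (pr : Prime p) (p-odd : p % 2 ≡ 1)
  (primitive-root : IsPrimitiveRoot 2 (p ^ 2)) (m : ℕ) (I : Subset p) (I≤ : ∣ I ∣ ≤ (p ∸ 1) / 2) where

  r : ℕ
  r = suc (suc m)

  open Complexity p pr p-odd primitive-root
  open Bounds r

  f : ℕ → Bool
  f = fseq p r I

  W : ℕ
  W = p ^ suc m * (p ∸ 1) * ∣ I ∣

  p^[r+1]≡N : p ^ (r + 1) ≡ N
  p^[r+1]≡N = cong (p ^_) (+-comm r 1)

  q≡ : q ≡ p ^ suc m * p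
  q≡ = *-comm p (p ^ suc m)

  f-unfold : ∀ u → f u ≡ unit (u % N) ∧ member I (toℕ (H p r (u % N)))
  f-unfold u = trans
    (cong (λ v → does (coprime? v p) ∧ does (H p r v ∈? I))
      (%-congʳ {m = p ^ (r + 1)} {n = N} {o = u} {{m^n≢0 p (r + 1)}} p^[r+1]≡N))
    (cong₂ _∧_ (coprime?-p (u % N)) (member-∈? (H p r (u % N)) I))

  f-periodic : Periodic N f
  f-periodic u = trans (f-unfold (u + N)) (trans
    (cong (λ v → unit v ∧ member I (toℕ (H p r v))) ([m+n]%n≡m%n u N)) (sym (f-unfold u)))

  unit-periodic-p : Periodic p unit
  unit-periodic-p u = trans (cong (λ x → unit (u + x)) (sym (+-identityʳ p))) (unit-+* u 1)

  unit-periodic : Periodic q unit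
  unit-periodic u = trans (cong (λ x → unit (u + x)) q≡) (unit-+* u (p ^ suc m))

  class<N : ∀ v j → v < q → j < p → v + j * q < N
  class<N v j v<q j<p = <-≤-trans (+-monoˡ-< (j * q) v<q) (*-monoˡ-≤ q j<p)

  f-class : ∀ v j → v < q → j < p → f (v + j * q) ≡ unit v ∧ member I (toℕ (H p r (v + j * q)))
  f-class v j v<q j<p = trans (f-unfold (v + j * q)) (trans
    (cong (λ x → unit x ∧ member I (toℕ (H p r x))) (m<n⇒m%n≡m (class<N v j v<q j<p)))
    (cong (_∧ member I (toℕ (H p r (v + j * q)))) (periodic-* unit-periodic j v)))

  H-distinct : ∀ v i j → p ∤ v → i < j → j < p → H p r (v + i * q) ≢ H p r (v + j * q)
  H-distinct v i j p∤v i<j j<p H≡ = >⇒∤ {{>-nonZero (m<n⇒0<n∸m i<j)}} (≤-<-trans (m∸n≤m j i) j<p)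
    (H-injective-mod-p m (v + i * q) (j ∸ i) p∤v+iq (trans (cong (H p r) regroup) (sym H≡)))
    where
    p∤v+iq : p ∤ v + i * q
    p∤v+iq p∣ = p∤v (∣m+n∣m⇒∣n (subst (p ∣_) (+-comm v (i * q)) p∣) (∣n⇒∣m*n i (m∣m*n (p ^ suc m))))
    regroup : v + i * q + (j ∸ i) * q ≡ v + j * q
    regroup = trans (+-assoc v (i * q) _) (cong (v +_) (trans (sym (*-distribʳ-+ q i (j ∸ i)))
      (cong (_* q) (m+[n∸m]≡n (<⇒≤ i<j)))))

  H-injective : ∀ v → p ∤ v → InjectiveBelow p (λ j → toℕ (H p r (v + j * q)))
  H-injective v p∤v i j i<p j<p eq with <-cmp i j
  ... | tri≈ _ i≡j _ = i≡j
  ... | tri< i<j _ _ = contradiction (Finₚ.toℕ-injective eq) (H-distinct v i j p∤v i<j j<p)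
  ... | tri> _ _ j<i = contradiction (Finₚ.toℕ-injective (sym eq)) (H-distinct v j i p∤v j<i i<p)

  count-class : ∀ v → v < q → Σℕ.sum p (λ j → [ f (v + j * q) ]) ≡ [ unit v ] * ∣ I ∣
  count-class v v<q = trans (Σℕ.sum-cong-< p λ j j<p → cong [_] (f-class v j v<q j<p)) count
    where
    open ≡-Reasoning
    top : ℕ → ℕ
    top j = toℕ (H p r (v + j * q))
    count : Σℕ.sum p (λ j → [ unit v ∧ member I (top j) ]) ≡ [ unit v ] * ∣ I ∣
    count with p ∣? v
    ... | yes p∣v = Σℕ.sum-ε p λ _ _ → refl
    ... | no p∤v = begin
      Σℕ.sum p (λ j → [ member I (top j) ])   ≡⟨ Σℕ.sum-reindex p top ([_] ∘ member I)
                                                  (λ j _ → Finₚ.toℕ<n _) (H-injective v p∤v) ⟩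
      Σℕ.sum p ([_] ∘ member I)               ≡⟨ sum-member I ⟩
      ∣ I ∣                                   ≡⟨ *-identityˡ ∣ I ∣ ⟨
      1 * ∣ I ∣                               ∎

  sum-count : Σℕ.sum q (λ v → [ unit v ] * ∣ I ∣) ≡ W
  sum-count = trans (sum-*ʳ q ([_] ∘ unit) ∣ I ∣) (cong (_* ∣ I ∣) (count-units (suc m)))

  fold-f : ∀ u → fold p q f u ≡ unit u ∧ isOdd ∣ I ∣
  fold-f u = begin
    fold p q f u                                 ≡⟨ periodic-% (fold-periodic p q f f-periodic) u ⟨
    fold p q f (u % q)                           ≡⟨ sum-isOdd p _ ⟩
    isOdd (Σℕ.sum p (λ j → [ f (u % q + j * q) ])) ≡⟨ cong isOdd (count-class (u % q) (m%n<n u q)) ⟩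
    isOdd ([ unit (u % q) ] * ∣ I ∣)             ≡⟨ isOdd-[]* (unit (u % q)) ⟩
    unit (u % q) ∧ isOdd ∣ I ∣                   ≡⟨ cong (_∧ isOdd ∣ I ∣) (periodic-% unit-periodic u) ⟩
    unit u ∧ isOdd ∣ I ∣                         ∎
    where
    open ≡-Reasoning
    isOdd-[]* : ∀ b → isOdd ([ b ] * ∣ I ∣) ≡ b ∧ isOdd ∣ I ∣
    isOdd-[]* true  = cong isOdd (*-identityˡ ∣ I ∣)
    isOdd-[]* false = refl

  -- As 2 |I| ≤ p - 1, the ones are a minority in each class of units, so 0 is the cheaper constant
  -- there.
  minority : ∀ X → ∣ I ∣ + X ≡ p → ∣ I ∣ ≤ X
  minority X eq = +-cancelˡ-≤ ∣ I ∣ ∣ I ∣ X (begin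
    ∣ I ∣ + ∣ I ∣        ≡⟨ ring ∣ I ∣ ⟩
    ∣ I ∣ * 2            ≤⟨ *-monoˡ-≤ 2 I≤ ⟩
    (p ∸ 1) / 2 * 2      ≤⟨ m/n*n≤m (p ∸ 1) 2 ⟩
    p ∸ 1                ≤⟨ m∸n≤m p 1 ⟩
    p                    ≡⟨ eq ⟨
    ∣ I ∣ + X            ∎)
    where
    open ≤-Reasoning
    ring : ∀ x → x + x ≡ x * 2
    ring = solve-∀

  -- A q-periodic t is constant on each class, and on a class of units it misses either the |I| ones
  -- or the p - |I| zeros of f.
  periodic⇒far : ∀ t → Periodic q t → W ≤ hamming N f t
  periodic⇒far t per = subst₂ _≤_ sum-count (sym (hamming-classes p q f t))
    (sum-mono-≤ q λ v v<q → subst ([ unit v ] * ∣ I ∣ ≤_)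
      (Σℕ.sum-cong p λ j → cong (λ b → [ f (v + j * q) xor b ]) (sym (periodic-* per j v)))
      (distance v v<q (t v)))
    where
    distance : ∀ v → v < q → ∀ b → [ unit v ] * ∣ I ∣ ≤ Σℕ.sum p (λ j → [ f (v + j * q) xor b ])
    distance v v<q false = ≤-reflexive (trans (sym (count-class v v<q))
      (Σℕ.sum-cong p λ j → cong [_] (sym (xor-identityʳ (f (v + j * q))))))
    distance v v<q true = subst ([ unit v ] * ∣ I ∣ ≤_)
        (Σℕ.sum-cong p λ j → cong [_] (xor-comm true (f (v + j * q))))
        (bound (unit v) (count-class v v<q))
      where
      bound : ∀ b → Σℕ.sum p (λ j → [ f (v + j * q) ]) ≡ [ b ] * ∣ I ∣ →
        [ b ] * ∣ I ∣ ≤ Σℕ.sum p (λ j → [ not (f (v + j * q)) ])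
      bound false _     = z≤n
      bound true  count = subst (_≤ Σℕ.sum p (λ j → [ not (f (v + j * q)) ])) (sym (*-identityˡ ∣ I ∣))
        (minority _ (trans (cong (_+ Σℕ.sum p (λ j → [ not (f (v + j * q)) ]))
          (sym (trans count (*-identityˡ ∣ I ∣)))) (sum-complement p λ j → f (v + j * q))))

  close⇒Δ-true : ∀ {k} t → k < W → Periodic N t → hamming N f t ≤ k → ∃ λ u → Δ q t u ≡ true
  close⇒Δ-true t k<W per close with Δ-true-or-periodic t per
  ... | inj₁ found = found
  ... | inj₂ per-q = contradiction (≤-trans (periodic⇒far t per-q) close) (<⇒≱ k<W)

  sum-unit : Σℕ.sum q ([_] ∘ unit) ≡ p ^ suc m * (p ∸ 1)
  sum-unit = count-units (suc m)

  sum-nonunit : Σℕ.sum q ([_] ∘ not ∘ unit) ≡ p ^ suc m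
  sum-nonunit = +-cancelˡ-≡ (p ^ suc m * (p ∸ 1)) _ _ (begin
    p ^ suc m * (p ∸ 1) + Σℕ.sum q ([_] ∘ not ∘ unit)      ≡⟨ cong (_+ Σℕ.sum q ([_] ∘ not ∘ unit)) sum-unit ⟨
    Σℕ.sum q ([_] ∘ unit) + Σℕ.sum q ([_] ∘ not ∘ unit)    ≡⟨ sum-complement q unit ⟩
    q                                                      ≡⟨ [p∸1]*q+q (p ^ suc m) ⟨
    (p ∸ 1) * p ^ suc m + p ^ suc m                        ≡⟨ cong (_+ p ^ suc m) (*-comm (p ∸ 1) (p ^ suc m)) ⟩
    p ^ suc m * (p ∸ 1) + p ^ suc m                        ∎)
    where open ≡-Reasoning

  -- Adds a prescribed h to the fold. All flips lie in the first q terms, which contain one member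
  -- of each class, so the cost is the weight of h over one period; by `hamming-fold` no cheaper way
  -- exists.
  module Perturbation (h : ℕ → Bool) (h-periodic : Periodic q h) where

    error : ℕ → Bool
    error u = does (u % N <? q) ∧ h u

    perturbed : ℕ → Bool
    perturbed u = f u xor error u

    error-periodic : Periodic N error
    error-periodic u = cong₂ (λ x y → does (x <? q) ∧ y) ([m+n]%n≡m%n u N)
      (periodic-* h-periodic p u)

    perturbed-periodic : Periodic N perturbed
    perturbed-periodic u = cong₂ _xor_ (f-periodic u) (error-periodic u)

    error-< : ∀ u → u < q → error u ≡ h u
    error-< u u<q = cong (_∧ h u) (dec-true (u % N <? q) (≤-<-trans (m%n≤m u N) u<q))

    error-≥ : ∀ u → q ≤ u → u < N → error u ≡ false
    error-≥ u q≤u u<N = cong (_∧ h u) (dec-false (u % N <? q)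
      (≤⇒≯ (subst (q ≤_) (sym (m<n⇒m%n≡m u<N)) q≤u)))

    q≤N : q ≤ N
    q≤N = subst (q ≤_) D+q≡N (m≤n+m q D)

    hamming-perturbed : hamming N f perturbed ≡ Σℕ.sum q ([_] ∘ h)
    hamming-perturbed = begin
      hamming N f perturbed                            ≡⟨ hamming-sum N f perturbed ⟩
      Σℕ.sum N (λ i → [ f i xor (f i xor error i) ])   ≡⟨ Σℕ.sum-cong N (λ i → cong [_] (cancel (f i) (error i))) ⟩
      Σℕ.sum N ([_] ∘ error)                           ≡⟨ Σℕ.sum-extend q N _ q≤N (λ i lo hi → cong [_] (error-≥ i lo hi)) ⟩
      Σℕ.sum q ([_] ∘ error)                           ≡⟨ Σℕ.sum-cong-< q (λ i i<q → cong [_] (error-< i i<q)) ⟩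
      Σℕ.sum q ([_] ∘ h)                               ∎
      where
      open ≡-Reasoning
      cancel : ∀ x y → x xor (x xor y) ≡ y
      cancel x y = trans (sym (xor-assoc x x y)) (cong (_xor y) (xor-same x))

    fold-error : ∀ u → fold p q error u ≡ h u
    fold-error u = begin
      fold p q error u           ≡⟨ periodic-% (fold-periodic p q error error-periodic) u ⟨
      fold p q error (u % q)     ≡⟨ Σ₂.sum-single p 0 _ (>-nonZero⁻¹ p) (λ j j<p j≢0 →
        error-≥ (u % q + j * q) (≤-trans (m≤n*m q j {{≢-nonZero j≢0}}) (m≤n+m (j * q) (u % q)))
          (class<N (u % q) j (m%n<n u q) j<p)) ⟩
      error (u % q + 0)          ≡⟨ cong error (+-identityʳ (u % q)) ⟩
      error (u % q)              ≡⟨ error-< (u % q) (m%n<n u q) ⟩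
      h (u % q)                  ≡⟨ periodic-% h-periodic u ⟩
      h u                        ∎
      where open ≡-Reasoning

    fold-perturbed : ∀ u → fold p q perturbed u ≡ fold p q f u xor h u
    fold-perturbed u = trans (Σ₂.sum-∙ p _ _) (cong (fold p q f u xor_) (fold-error u))

    perturbed-recurrence : ∀ b → b < q → (∀ u → Σ₂.sum (suc b) (λ i → fold p q f (u + i) xor h (u + i)) ≡ false) →
      HasRecurrence perturbed (D + b)
    perturbed-recurrence b b<q window = window-recurrence perturbed b b<q λ u →
      trans (Σ₂.sum-cong (suc b) λ i → fold-perturbed (u + i)) (window u)

    perturbed-kErrorLC : ∀ {k} b → b < q → Σℕ.sum q ([_] ∘ h) ≤ k →
      (∀ u → Σ₂.sum (suc b) (λ i → fold p q f (u + i) xor h (u + i)) ≡ false) →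
      (∀ t L → Periodic N t → hamming N f t ≤ k → HasRecurrence t L → D + b ≤ L) →
      IsKErrorLC N k f (D + b)
    perturbed-kErrorLC {k} b b<q close window minimal = kErrorLC perturbed perturbed-periodic
      (subst (_≤ k) (sym hamming-perturbed) close) (perturbed-recurrence b b<q window) minimal

  kErrorLC-0 : ∀ k → W ≤ k → IsKErrorLC N k f 0
  kErrorLC-0 k W≤k = kErrorLC (λ _ → false) (λ _ → refl) (subst (_≤ k) (sym weight) W≤k)
    ((λ ()) , _ , λ _ → refl) (λ _ _ _ _ _ → z≤n)
    where
    weight : hamming N f (λ _ → false) ≡ W
    weight = trans (hamming-classes p q f (λ _ → false)) (trans (Σℕ.sum-cong-< q λ v v<q →
      trans (Σℕ.sum-cong p λ j → cong [_] (xor-identityʳ (f (v + j * q)))) (count-class v v<q)) sum-count)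

  -- Adding the fold of f to itself annihilates it, after which Φ_N alone gives a recurrence.
  kErrorLC-D : ∀ k (h : ℕ → Bool) → Periodic q h → (∀ u → fold p q f u ≡ h u) →
    Σℕ.sum q ([_] ∘ h) ≤ k → k < W → IsKErrorLC N k f D
  kErrorLC-D k h h-periodic fold≡h close k<W = subst (IsKErrorLC N k f) (+-identityʳ D)
    (perturbed-kErrorLC 0 q>0 close window λ t L per close′ rec →
      let u , Δu = close⇒Δ-true t k<W per close′ in
      subst (_≤ L) (sym (+-identityʳ D)) (complexity≥D t per u Δu L rec))
    where
    open Perturbation h h-periodic
    window : ∀ u → Σ₂.sum 1 (λ i → fold p q f (u + i) xor h (u + i)) ≡ false
    window u = trans (xor-identityʳ _)
      (trans (cong (_xor h (u + 0)) (fold≡h (u + 0))) (xor-same (h (u + 0))))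

  -- The thresholds for odd |I|

  module OddSize (I-odd : isOdd ∣ I ∣ ≡ true) where

    fold-f-odd : ∀ u → fold p q f u ≡ unit u
    fold-f-odd u = trans (fold-f u) (trans (cong (unit u ∧_) I-odd) (∧-identityʳ (unit u)))

    p^[r-1]≤ : p ^ suc m ≤ p ^ suc m * (p ∸ 1)
    p^[r-1]≤ = m≤m*n (p ^ suc m) (p ∸ 1) {{>-nonZero p∸1>0}}

    ≤W : p ^ suc m * (p ∸ 1) ≤ W
    ≤W = m≤m*n (p ^ suc m * (p ∸ 1)) ∣ I ∣ {{>-nonZero (≢0 I-odd)}}
      where
      ≢0 : ∀ {x} → isOdd x ≡ true → 0 < x
      ≢0 {suc x} _ = s≤s z≤n

    distance-to-fold : ∀ t (c : Bool) → (∀ u → fold p q t u ≡ c) →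
      Σℕ.sum q (λ v → [ unit v xor c ]) ≤ hamming N f t
    distance-to-fold t c fold≡c = subst (_≤ hamming N f t)
      (Σℕ.sum-cong q λ v → cong₂ (λ x y → [ x xor y ]) (fold-f-odd v) (fold≡c v))
      (hamming-fold p q f t)

    -- A zero fold would differ from `unit` at every unit below q, which costs p^(r-1) (p - 1)
    -- errors.
    fold-true : ∀ {k} t → k < p ^ suc m * (p ∸ 1) → Periodic N t → hamming N f t ≤ k →
      ∃ λ u → fold p q t u ≡ true
    fold-true t k< per close with true-or-all-false q (fold p q t) (fold-periodic p q t per)
    ... | inj₁ found     = found
    ... | inj₂ all-false = contradiction (≤-trans (subst (_≤ hamming N f t)
        (trans (Σℕ.sum-cong q λ v → cong [_] (xor-identityʳ (unit v))) sum-unit)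
        (distance-to-fold t false all-false)) close) (<⇒≱ k<)

    -- A fold constantly 1 would differ from `unit` at the p^(r-1) multiples of p below q.
    fold-false : ∀ {k} t → k < p ^ suc m → Periodic N t → hamming N f t ≤ k →
      ∃ λ u → fold p q t u ≡ false
    fold-false t k< per close with true-or-all-false q (not ∘ fold p q t)
      (λ u → cong not (fold-periodic p q t per u))
    ... | inj₁ (u , eq)  = u , trans (sym (not-involutive _)) (cong not eq)
    ... | inj₂ all-false = contradiction (≤-trans (subst (_≤ hamming N f t)
        (trans (Σℕ.sum-cong q λ v → cong [_] (xor-comm (unit v) true)) sum-nonunit)
        (distance-to-fold t true λ u → trans (sym (not-involutive _)) (cong not (all-false u)))) close)
      (<⇒≱ k<)

    p∸1<q : p ∸ 1 < q
    p∸1<q = <-≤-trans p∸1<p (m≤m*n p (p ^ suc m) {{m^n≢0 p (suc m)}})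

    -- Attained by f unchanged: any p consecutive integers contain p - 1 units, an even number, so 1
    -- + X + ⋯ + X^(p-1) kills the fold.
    kErrorLC-D+p∸1 : ∀ k → k < p ^ suc m → IsKErrorLC N k f (D + (p ∸ 1))
    kErrorLC-D+p∸1 k k< = perturbed-kErrorLC (p ∸ 1) p∸1<q no-errors window
      λ t L per close rec →
        let k<′   = <-≤-trans k< p^[r-1]≤
            u , Δu = close⇒Δ-true t (<-≤-trans k<′ ≤W) per close
            v , gv = fold-true t k<′ per close
            w , gw = fold-false t k< per close
        in complexity≥D+p∸1 t per u Δu (<⇒≤ p∸1<q) v w gv gw L rec
      where
      open Perturbation (λ _ → false) (λ _ → refl)
      no-errors : Σℕ.sum q (λ _ → 0) ≤ k
      no-errors = subst (_≤ k) (sym (Σℕ.sum-ε q λ _ _ → refl)) z≤n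
      isOdd-p∸1 : isOdd (p ∸ 1) ≡ false
      isOdd-p∸1 = trans (sym (not-involutive _)) (cong not (trans (cong isOdd (sym p≡1+[p∸1]))
        (trans (isOdd-% p) (cong isOdd p-odd))))
      window : ∀ u → Σ₂.sum (suc (p ∸ 1)) (λ i → fold p q f (u + i) xor false) ≡ false
      window u = begin
        Σ₂.sum (suc (p ∸ 1)) (λ i → fold p q f (u + i) xor false)
          ≡⟨ cong (λ n → Σ₂.sum n (λ i → fold p q f (u + i) xor false)) p≡1+[p∸1] ⟨
        Σ₂.sum p (λ i → fold p q f (u + i) xor false)
          ≡⟨ Σ₂.sum-cong p (λ i → trans (xor-identityʳ _) (fold-f-odd (u + i))) ⟩
        Σ₂.sum p (λ i → unit (u + i))
          ≡⟨ sum-window p unit unit-periodic-p u ⟩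
        Σ₂.sum p unit
          ≡⟨ sum-isOdd p unit ⟩
        isOdd (Σℕ.sum p ([_] ∘ unit))
          ≡⟨ cong isOdd count-units-p ⟩
        isOdd (p ∸ 1)
          ≡⟨ isOdd-p∸1 ⟩
        false ∎
        where open ≡-Reasoning

    -- One flip in each class of multiples of p makes the fold constantly 1, which 1 + X kills.
    kErrorLC-D+1 : ∀ k → p ^ suc m ≤ k → k < p ^ suc m * (p ∸ 1) → IsKErrorLC N k f (D + 1)
    kErrorLC-D+1 k ≤k k< = perturbed-kErrorLC 1 (≤-<-trans p∸1>0 p∸1<q)
      (subst (_≤ k) (sym sum-nonunit) ≤k) window
      λ t L per close rec →
        let u , Δu = close⇒Δ-true t (<-≤-trans k< ≤W) per close
            v , gv = fold-true t k< per close
        in complexity≥D+1 t per u Δu v gv L rec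
      where
      open Perturbation (not ∘ unit) (λ u → cong not (unit-periodic u))
      always-true : ∀ u → fold p q f u xor not (unit u) ≡ true
      always-true u = trans (cong (_xor not (unit u)) (fold-f-odd u)) (complementary (unit u))
        where
        complementary : ∀ b → b xor not b ≡ true
        complementary true  = refl
        complementary false = refl
      window : ∀ u → Σ₂.sum 2 (λ i → fold p q f (u + i) xor not (unit (u + i))) ≡ false
      window u = cong₂ (λ x y → x xor (y xor false)) (always-true (u + 1)) (always-true (u + 0))

    kErrorLC-D-odd : ∀ k → p ^ suc m * (p ∸ 1) ≤ k → k < W → IsKErrorLC N k f D
    kErrorLC-D-odd k ≤k = kErrorLC-D k unit unit-periodic fold-f-odd (subst (_≤ k) (sym sum-unit) ≤k)

  kErrorLC-D-even : isOdd ∣ I ∣ ≡ false → ∀ k → k < W → IsKErrorLC N k f D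
  kErrorLC-D-even I-even k = kErrorLC-D k (λ _ → false) (λ _ → refl)
    (λ u → trans (fold-f u) (trans (cong (unit u ∧_) I-even) (∧-zeroʳ (unit u))))
    (subst (_≤ k) (sym (Σℕ.sum-ε q λ _ _ → refl)) z≤n)

  D≡ : p ^ (r + 1) ∸ p ^ r ≡ D
  D≡ = trans (cong (_∸ q) (trans p^[r+1]≡N (sym D+q≡N))) (m+n∸n≡m D q)

  restate : ∀ {k L L′} → L ≡ L′ → IsKErrorLC N k f L′ → IsKErrorLC (p ^ (r + 1)) k f L
  restate {k} {L} refl = subst (λ T → IsKErrorLC T k f L) (sym p^[r+1]≡N)

theorem4 : (p : ℕ) .{{_ : NonZero p}} → Prime p → p % 2 ≡ 1 →
    IsPrimitiveRoot 2 (p ^ 2) →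
    (r : ℕ) → 2 ≤ r →
    (I : Subset p) → 1 ≤ ∣ I ∣ → ∣ I ∣ ≤ (p ∸ 1) / 2 →
    (∣ I ∣ % 2 ≡ 1 →
      (∀ k → k < p ^ (r ∸ 1) →
        IsKErrorLC (p ^ (r + 1)) k (fseq p r I) (p ^ (r + 1) ∸ p ^ r + p ∸ 1)) ×
      (∀ k → p ^ (r ∸ 1) ≤ k → k < p ^ (r ∸ 1) * (p ∸ 1) →
        IsKErrorLC (p ^ (r + 1)) k (fseq p r I) (p ^ (r + 1) ∸ p ^ r + 1)) ×
      (∀ k → p ^ (r ∸ 1) * (p ∸ 1) ≤ k → k < p ^ (r ∸ 1) * (p ∸ 1) * ∣ I ∣ →
        IsKErrorLC (p ^ (r + 1)) k (fseq p r I) (p ^ (r + 1) ∸ p ^ r)) ×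
      (∀ k → p ^ (r ∸ 1) * (p ∸ 1) * ∣ I ∣ ≤ k →
        IsKErrorLC (p ^ (r + 1)) k (fseq p r I) 0)) ×
    (∣ I ∣ % 2 ≡ 0 →
      (∀ k → k < p ^ (r ∸ 1) * (p ∸ 1) * ∣ I ∣ →
        IsKErrorLC (p ^ (r + 1)) k (fseq p r I) (p ^ (r + 1) ∸ p ^ r)) ×
      (∀ k → p ^ (r ∸ 1) * (p ∸ 1) * ∣ I ∣ ≤ k →
        IsKErrorLC (p ^ (r + 1)) k (fseq p r I) 0))
theorem4 p pr p-odd primitive-root (suc zero) (s≤s ())
theorem4 p pr p-odd primitive-root (suc (suc m)) _ I _ I≤ =
  (λ I-odd → let open OddSize (trans (isOdd-% ∣ I ∣) (cong isOdd I-odd)) in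
    (λ k k< → restate (trans (+-∸-assoc _ (<⇒≤ 1<p)) (cong (_+ (p ∸ 1)) D≡)) (kErrorLC-D+p∸1 k k<)) ,
    (λ k ≤k k< → restate (cong (_+ 1) D≡) (kErrorLC-D+1 k ≤k k<)) ,
    (λ k ≤k k< → restate D≡ (kErrorLC-D-odd k ≤k k<)) ,
    (λ k W≤k → restate refl (kErrorLC-0 k W≤k))) ,
  (λ I-even →
    (λ k k< → restate D≡ (kErrorLC-D-even (trans (isOdd-% ∣ I ∣) (cong isOdd I-even)) k k<)) ,
    (λ k W≤k → restate refl (kErrorLC-0 k W≤k)))
  where
  open Complexity p pr p-odd primitive-root using (1<p)
  open TopDigitSequence p pr p-odd primitive-root m I I≤
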